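{- Let $G=(V,E)$ be a finite digraph with minimum out-degree at least $15$. Then there exists $u\in V$ such that for every $w\in V\setminus\{u\}$ there exists a friendly partition of $G$ that separates $u$ and $w$ (i.e. $u$ and $w$ lie in different parts).
   Context: Digraphs have no loops and no parallel arcs in the same direction. A friendly partition of a digraph $G=(V,E)$ is a partition $\{V_1,V_2\}$ of $V$ into two nonempty sets such that every vertex has at least one out-neighbor in its own part. -}

module Defs where

open import Data.Nat using (ℕ; _≤_)
open import Data.Fin using (Fin)
open import Data.Bool using (Bool; true; false)
open import Data.Product using (Σ; ∃; _×_; _,_)
open import Data.List using (List; filter; length)
open import Data.List using () renaming (allFin to allFinL)
open import Relation.Binary.PropositionalEquality using (_≡_; _≢_)
open import Relation.Nullary using (¬_)
open import Data.Bool using (_≟_)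

-- A finite digraph on vertex set Fin n: arcs given by a Boolean adjacency
-- relation (so there are no parallel arcs in the same direction), loopless.
record Digraph (n : ℕ) : Set where
  field
    arc     : Fin n → Fin n → Bool
    loopless : ∀ v → arc v v ≡ false
open Digraph public

outNbrs : ∀ {n} → Digraph n → Fin n → List (Fin n)
outNbrs G v = filter (λ w → arc G v w ≟ true) (allFinL _)

outDeg : ∀ {n} → Digraph n → Fin n → ℕ
outDeg G v = length (outNbrs G v)

MinOutDegAtLeast : ∀ {n} → Digraph n → ℕ → Set
MinOutDegAtLeast G k = ∀ v → k ≤ outDeg G v

-- A partition {V₁, V₂} of V is represented by the side function
-- side : Fin n → Bool (V₁ = side⁻¹ true, V₂ = side⁻¹ false).
-- It is friendly if both parts are nonempty and every vertex has an
-- out-neighbour in its own part.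
Friendly : ∀ {n} → Digraph n → (Fin n → Bool) → Set
Friendly {n} G side =
  (∃ λ v → side v ≡ true) × (∃ λ v → side v ≡ false) ×
  (∀ v → ∃ λ w → arc G v w ≡ true × side w ≡ side v)

Separates : ∀ {n} → (Fin n → Bool) → Fin n → Fin n → Set
Separates side u w = side u ≢ side w

{-# OPTIONS --safe #-}
-- Call a set self-sustaining if each of its vertices has an out-neighbour in it. Two vertices are
-- separated by a friendly partition iff they lie in disjoint self-sustaining sets, so not being
-- separated is an equivalence relation, and a vertex that is a class of its own is wanted.
--
-- Consider a counterexample with fewest vertices (loops are allowed). No proper nonempty subset is closed
-- under out-neighbours, and every arc c → y between separated vertices has a common in-neighbour
-- of c and y: otherwise contract it. Take as many disjoint self-sustaining sets as possible, and
-- shrink them to minimal ones; these are induced cycles C_i, and what remains is acyclic. A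
-- remaining vertex whose out-neighbours are drawn to different cycles would be a singleton class.
-- Hence V splits into parts A_i ⊇ C_i such that A_i ∖ C_i has out-neighbours in A_i only, and
-- similar arguments show that c ∈ C_i sends arcs to its successor on C_i and otherwise into a single
-- other part A_(J i), for a permutation J. The common in-neighbours now force two vertices of
-- A_(J i) to receive arcs from all of C_i. Sending these two entries of every part along disjoint
-- paths to the cycle of that part splits V so that an entry becomes a singleton class.

module Submission where

open import Defs
open import Data.Nat using (ℕ; ≢-nonZero⁻¹; NonZero; zero; suc; _+_; _≤_; _<_; z≤n; s≤s; _≤?_; _<?_)
open import Data.Nat.Properties using (≤-refl; ≤-trans; ≤-total; ≤-pred; <-cmp; <⇒≤; <-≤-trans; ≮⇒≥; n≮n; 1+n≰n; +-monoˡ-<; +-monoʳ-<; +-comm; +-suc; m<m+n; 0≢1+n; suc-injective; m≤n⇒m<n∨m≡n)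
open import Data.Fin using (Fin; zero; suc; punchOut; _≟_)
open import Data.Fin.Properties using (any?; all?; injective⇒≤; punchOut-injective)
open import Data.Fin.Subset using (Subset; _∈_; _∉_; _⊆_; _⊂_; Nonempty; ⊤)
open import Data.Fin.Subset.Properties using (_∈?_; _⊆?_; _⊂?_; anySubset?; nonempty?; ∈⊤)
open import Data.Fin.Subset.Induction using (⊂-wellFounded; Acc; acc)
open import Data.Vec using (tabulate)
open import Data.Vec.Properties using (lookup⇒[]=; []=⇒lookup; lookup∘tabulate)
open import Data.List using (List; []; _∷_; length; map; filter; allFin)
open import Data.List.Properties using (length-map; filter-notAll)
open import Data.List.Relation.Unary.All as All using (All; []; _∷_)
import Data.List.Relation.Unary.All.Properties as All
open import Data.List.Relation.Unary.Any as Any using (here; there)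
open import Data.List.Relation.Unary.Unique.Propositional using (Unique; _∷_)
open import Data.List.Relation.Unary.Unique.Propositional.Properties using (filter⁺; allFin⁺)
open import Data.List.Membership.Propositional using () renaming (_∈_ to _∈ₗ_)
open import Data.List.Membership.Propositional.Properties using (∈-filter⁺; ∈-filter⁻)
open import Data.Bool as Bool using (Bool; true; false; if_then_else_)
open import Data.Empty using (⊥; ⊥-elim)
open import Data.Product using (∃; _×_; _,_; proj₁; proj₂)
open import Data.Sum using (_⊎_; inj₁; inj₂)
open import Function using (_∘_; case_of_)
open import Relation.Binary.PropositionalEquality using (_≡_; _≢_; refl; sym; trans; cong; subst)
open import Relation.Binary.Definitions using (tri<; tri≈; tri>)
open import Relation.Nullary using (Dec; yes; no; does; ¬_; ¬?; _×-dec_; _⊎-dec_; _→-dec_)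
open import Relation.Nullary.Decidable using (True; toWitness; dec-true; dec-false)

-- Subsets of a finite vertex set cut out by decidable predicates.

does-true : ∀ {A : Set} (a? : Dec A) → does a? ≡ true → A
does-true (yes a) _ = a

opaque
  ⟪_⟫ : ∀ {n} {P : Fin n → Set} → (∀ x → Dec (P x)) → Subset n
  ⟪ P? ⟫ = tabulate (λ x → does (P? x))

opaque
  unfolding ⟪_⟫

  ∈⁺ : ∀ {n} {P : Fin n → Set} {P? : ∀ x → Dec (P x)} {x} → P x → x ∈ ⟪ P? ⟫
  ∈⁺ {P? = P?} {x} p = lookup⇒[]= x _ (trans (lookup∘tabulate _ x) (dec-true (P? x) p))

  ∈⁻ : ∀ {n} {P : Fin n → Set} {P? : ∀ x → Dec (P x)} {x} → x ∈ ⟪ P? ⟫ → P x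
  ∈⁻ {P? = P?} {x} x∈ = does-true (P? x) (trans (sym (lookup∘tabulate _ x)) ([]=⇒lookup x∈))

_∖_ : ∀ {n} → Subset n → Fin n → Subset n
S ∖ c = ⟪ (λ x → (x ∈? S) ×-dec ¬? (x ≟ c)) ⟫

add : ∀ {n} → Fin n → Subset n → Subset n
add v S = ⟪ (λ x → (x ∈? S) ⊎-dec (x ≟ v)) ⟫

Disjoint : ∀ {n} → Subset n → Subset n → Set
Disjoint S S′ = ∀ v → v ∈ S → v ∉ S′

disjoint? : ∀ {n} (S S′ : Subset n) → Dec (Disjoint S S′)
disjoint? S S′ = all? λ v → (v ∈? S) →-dec ¬? (v ∈? S′)

∖-⊂ : ∀ {n} {S : Subset n} {c} → c ∈ S → S ∖ c ⊂ S
∖-⊂ c∈S = proj₁ ∘ ∈⁻ , _ , c∈S , λ c∈ → proj₂ (∈⁻ c∈) refl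

opaque
  argmax : ∀ {n} (ρ : Fin n → ℕ) (X : Subset n) → Nonempty X → ∃ λ y → y ∈ X × (∀ x → x ∈ X → ρ x ≤ ρ y)
  argmax {n} ρ X = go X (⊂-wellFounded X)
    where
    go : ∀ X → Acc _⊂_ X → Nonempty X → ∃ λ y → y ∈ X × (∀ x → x ∈ X → ρ x ≤ ρ y)
    go X (acc rs) (x , x∈X) with nonempty? ⟪ (λ z → (z ∈? X) ×-dec (ρ x <? ρ z)) ⟫
    ... | no ¬above = x , x∈X , λ z z∈X → ≮⇒≥ λ x<z → ¬above (z , ∈⁺ (z∈X , x<z))
    ... | yes above
          with y , y∈ , top ← go _ (rs (proj₁ ∘ ∈⁻ , x , x∈X , λ x∈ → n≮n _ (proj₂ (∈⁻ x∈)))) above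
          = y , proj₁ (∈⁻ y∈) , λ z z∈X → case ρ x <? ρ z of λ where
              (yes x<z) → top z (∈⁺ (z∈X , x<z))
              (no x≮z) → ≤-trans (≮⇒≥ x≮z) (<⇒≤ (proj₂ (∈⁻ y∈)))

opaque
  -- If `g (f a)` differs from `a`, then `a` is no value of `g`. As `g` is injective, punching out
  -- `a` would inject `Fin (suc n)` into `Fin n`.
  right-inverse⇒left-inverse : ∀ {n} (f g : Fin n → Fin n) → (∀ x → f (g x) ≡ x) → ∀ a → g (f a) ≡ a
  right-inverse⇒left-inverse {suc n} f g fg a with g (f a) ≟ a
  ... | yes p = p
  ... | no gfa≢a = ⊥-elim (1+n≰n (injective⇒≤ {f = λ x → punchOut (a≢g x)} λ {x} {y} eq →
    trans (sym (fg x)) (trans (cong f (punchOut-injective (a≢g x) (a≢g y) eq)) (fg y))))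
    where
    a≢g : ∀ x → a ≢ g x
    a≢g x refl = gfa≢a (cong g (fg x))

-- Self-sustaining sets, separation and singleton classes.

module _ {n : ℕ} (E : Fin n → Fin n → Set) (V : Subset n) where

  -- Two disjoint such sets extend to a friendly partition; see sep⇒friendly.
  Self : Subset n → Set
  Self S = S ⊆ V × (∀ v → v ∈ S → ∃ λ w → w ∈ S × E v w)

  Sep : Fin n → Fin n → Set
  Sep u w = ∃ λ S → ∃ λ S′ → Self S × Self S′ × Disjoint S S′ × u ∈ S × w ∈ S′

  Single : Fin n → Set
  Single u = u ∈ V × (∀ w → w ∈ V → w ≢ u → Sep u w)

  -- Out-degree at least 15, in a form that survives the contraction of an arc without counting.
  Big : Set
  Big = ∀ v → v ∈ V → ∀ xs → length xs ≤ 14 → ∃ λ w → w ∈ V × E v w × All (w ≢_) xs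

  -- For `D ⊆ V` this amounts to having no directed cycle inside `D`; in this form it yields a sink
  -- of any nonempty subset at once.
  Acyclic : Subset n → Set
  Acyclic D = ∀ X → X ⊆ D → Self X → ∀ v → v ∉ X

  Minimal : Subset n → Set
  Minimal C = Self C × Nonempty C × (∀ X → X ⊆ C → Self X → Nonempty X → C ⊆ X)

  record Packing (k : ℕ) : Set where
    field
      C        : Fin k → Subset n
      self     : ∀ i → Self (C i)
      inhab    : ∀ i → Nonempty (C i)
      disjoint : ∀ {i j v} → v ∈ C i → v ∈ C j → i ≡ j

-- The induction hypothesis. It ranges over all arc relations because contraction changes the arcs;
-- vertices are removed by shrinking `V`, which avoids renumbering.
Smaller : ∀ {n} → Subset n → Set₁
Smaller {n} V = ∀ {E : Fin n → Fin n → Set} → (∀ v w → Dec (E v w)) → ∀ {V′} → V′ ⊂ V → Nonempty V′ →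
  Big E V′ → ∃ (Single E V′)

-- Decidability, ranks, and minimal self-sustaining sets as induced cycles.

module _ {n : ℕ} {E : Fin n → Fin n → Set} (E? : ∀ v w → Dec (E v w)) {V : Subset n} where

  self? : ∀ S → Dec (Self E V S)
  self? S = (S ⊆? V) ×-dec all? λ v → (v ∈? S) →-dec any? λ w → (w ∈? S) ×-dec E? v w

  sep? : ∀ u w → Dec (Sep E V u w)
  sep? u w = anySubset? λ S → anySubset? λ S′ →
    self? S ×-dec self? S′ ×-dec disjoint? S S′ ×-dec (u ∈? S) ×-dec (w ∈? S′)

  single? : ∀ u → Dec (Single E V u)
  single? u = (u ∈? V) ×-dec all? λ w → (w ∈? V) →-dec (¬? (w ≟ u) →-dec sep? u w)

  self-add : ∀ {S v w} → Self E V S → v ∈ V → w ∈ S → E v w → Self E V (add v S)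
  self-add {S} {v} {w} (S⊆V , nxt) v∈V w∈S vw = within , next
    where
    within : add v S ⊆ V
    within x∈ with ∈⁻ x∈
    ... | inj₁ x∈S = S⊆V x∈S
    ... | inj₂ refl = v∈V
    next : ∀ x → x ∈ add v S → ∃ λ y → y ∈ add v S × E x y
    next x x∈ with ∈⁻ x∈
    ... | inj₁ x∈S = let y , y∈S , xy = nxt x x∈S in y , ∈⁺ (inj₁ y∈S) , xy
    ... | inj₂ refl = w , ∈⁺ (inj₁ w∈S) , vw

  opaque
    sink-or-self : ∀ X → X ⊆ V → (∃ λ s → s ∈ X × (∀ w → w ∈ X → ¬ E s w)) ⊎ Self E V X
    sink-or-self X X⊆V with any? (λ s → (s ∈? X) ×-dec all? λ w → (w ∈? X) →-dec ¬? (E? s w))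
    ... | yes s = inj₁ s
    ... | no ¬s = inj₂ (X⊆V , λ v v∈X → case any? (λ w → (w ∈? X) ×-dec E? v w) of λ where
      (yes p) → p
      (no ¬p) → ⊥-elim (¬s (v , v∈X , λ w w∈X vw → ¬p (w , w∈X , vw))))

  sink : ∀ {D X v} → Acyclic E V D → X ⊆ D → X ⊆ V → v ∈ X → ∃ λ s → s ∈ X × (∀ w → w ∈ X → ¬ E s w)
  sink {X = X} {v} ac X⊆D X⊆V v∈X with sink-or-self X X⊆V
  ... | inj₁ s = s
  ... | inj₂ self = ⊥-elim (ac X X⊆D self v v∈X)

  opaque
    -- Sinks are peeled off one at a time: the removed sink gets rank 0 and all other ranks go up by
    -- one.
    rank : ∀ {D} → Acyclic E V D → D ⊆ V →
      ∃ λ (ρ : Fin n → ℕ) → ∀ v w → v ∈ D → w ∈ D → E v w → ρ w < ρ v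
    rank {D} ac D⊆V = go D (⊂-wellFounded D) (λ x → x)
      where
      go : ∀ X → Acc _⊂_ X → X ⊆ D → ∃ λ (ρ : Fin n → ℕ) → ∀ v w → v ∈ X → w ∈ X → E v w → ρ w < ρ v
      go X (acc rs) X⊆D with nonempty? X
      ... | no empty = (λ _ → 0) , λ v w v∈X → ⊥-elim (empty (v , v∈X))
      ... | yes (_ , x∈X) with s , s∈X , s-sink ← sink ac X⊆D (D⊆V ∘ X⊆D) x∈X
                          with ρ , ρ↓ ← go (X ∖ s) (rs (∖-⊂ s∈X)) (X⊆D ∘ proj₁ ∘ ∈⁻)
                          = ρ′ , ρ′↓
        where
        ρ′ : Fin n → ℕ
        ρ′ v = if does (v ≟ s) then 0 else suc (ρ v)
        ρ′↓ : ∀ v w → v ∈ X → w ∈ X → E v w → ρ′ w < ρ′ v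
        ρ′↓ v w v∈X w∈X vw with v ≟ s | w ≟ s
        ... | yes refl | _ = ⊥-elim (s-sink w w∈X vw)
        ... | no _ | yes _ = s≤s z≤n
        ... | no v≢s | no w≢s = s≤s (ρ↓ v w (∈⁺ (v∈X , v≢s)) (∈⁺ (w∈X , w≢s)) vw)

  opaque
    minimal : ∀ S → Self E V S → Nonempty S → ∃ λ C → C ⊆ S × Minimal E V C
    minimal S = go S (⊂-wellFounded S)
      where
      go : ∀ S → Acc _⊂_ S → Self E V S → Nonempty S → ∃ λ C → C ⊆ S × Minimal E V C
      go S (acc rs) self ne with anySubset? (λ X → (X ⊂? S) ×-dec self? X ×-dec nonempty? X)
      ... | yes (X , X⊂S , self′ , ne′) =
        let C , C⊆X , m = go X (rs X⊂S) self′ ne′ in C , proj₁ X⊂S ∘ C⊆X , m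
      ... | no ¬X = S , (λ x → x) , self , ne , λ X X⊆S self′ ne′ {x} x∈S → case x ∈? X of λ where
        (yes x∈X) → x∈X
        (no x∉X) → ⊥-elim (¬X (X , (X⊆S , x , x∈S , x∉X) , self′ , ne′))

  -- `prev-closed` is induction around the cycle: a property handed from each vertex to its
  -- predecessor spreads from one vertex to all of `C`.
  record Cycle (C : Subset n) : Set₁ where
    field
      next prev  : Fin n → Fin n
      next-∈     : ∀ {v} → v ∈ C → next v ∈ C
      prev-∈     : ∀ {v} → v ∈ C → prev v ∈ C
      next-arc   : ∀ {v} → v ∈ C → E v (next v)
      prev-next  : ∀ v → prev (next v) ≡ v
      chordless  : ∀ {v w} → v ∈ C → w ∈ C → E v w → w ≡ next v
      prev-closed : ∀ {P : Fin n → Set} → (∀ v → Dec (P v)) → (∀ v → v ∈ C → P v → P (prev v)) →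
        ∀ {v} → v ∈ C → P v → ∀ {w} → w ∈ C → P w

  -- The image of any choice of out-neighbours inside C is again self-sustaining,
  -- hence all of C, so every such choice permutes C.
  opaque
    cycle : ∀ {C} → Minimal E V C → Cycle C
    cycle {C} ((C⊆V , nxt) , ne , least) = record
      { next = f ; prev = g ; next-∈ = f-∈ ; prev-∈ = g-∈ ; next-arc = f-arc
      ; prev-next = gf ; chordless = chordless ; prev-closed = prev-closed }
      where
      onto : (h : Fin n → Fin n) → (∀ v → v ∈ C → h v ∈ C × E v (h v)) →
        ∀ {x} → x ∈ C → ∃ λ v → v ∈ C × h v ≡ x
      onto h hC x∈C = ∈⁻ (least Im (λ x∈ → let v , v∈C , eq = ∈⁻ x∈ in subst (_∈ C) eq (proj₁ (hC v v∈C)))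
        ((λ x∈ → let v , v∈C , eq = ∈⁻ x∈ in C⊆V (subst (_∈ C) eq (proj₁ (hC v v∈C))))
         , λ x x∈ → let v , v∈C , eq = ∈⁻ x∈ ; x∈C = subst (_∈ C) eq (proj₁ (hC v v∈C))
                    in h x , ∈⁺ (x , x∈C , refl) , proj₂ (hC x x∈C))
        (let v , v∈C = ne in h v , ∈⁺ (v , v∈C , refl)) x∈C)
        where
        Im : Subset n
        Im = ⟪ (λ x → any? λ v → (v ∈? C) ×-dec (h v ≟ x)) ⟫
      f : Fin n → Fin n
      f v with v ∈? C
      ... | yes v∈C = proj₁ (nxt v v∈C)
      ... | no _ = v
      fC : ∀ v → v ∈ C → f v ∈ C × E v (f v)
      fC v v∈C with v ∈? C
      ... | yes p = proj₂ (nxt v p)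
      ... | no ¬p = ⊥-elim (¬p v∈C)
      f-∉ : ∀ v → v ∉ C → f v ≡ v
      f-∉ v v∉C with v ∈? C
      ... | yes p = ⊥-elim (v∉C p)
      ... | no _ = refl
      f-∈ : ∀ {v} → v ∈ C → f v ∈ C
      f-∈ v∈C = proj₁ (fC _ v∈C)
      f-arc : ∀ {v} → v ∈ C → E v (f v)
      f-arc v∈C = proj₂ (fC _ v∈C)
      f-onto : ∀ x → ∃ λ v → f v ≡ x
      f-onto x with x ∈? C
      ... | yes x∈C = let v , _ , eq = onto f fC x∈C in v , eq
      ... | no x∉C = x , f-∉ x x∉C
      g : Fin n → Fin n
      g x = proj₁ (f-onto x)
      fg : ∀ x → f (g x) ≡ x
      fg x = proj₂ (f-onto x)
      gf : ∀ v → g (f v) ≡ v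
      gf = right-inverse⇒left-inverse f g fg
      g-∈ : ∀ {v} → v ∈ C → g v ∈ C
      g-∈ {v} v∈C with g v ∈? C
      ... | yes p = p
      ... | no ¬p = ⊥-elim (¬p (subst (_∈ C) (trans (sym (fg v)) (f-∉ (g v) ¬p)) v∈C))
      chordless : ∀ {v w} → v ∈ C → w ∈ C → E v w → w ≡ f v
      chordless {v} {w} v∈C w∈C vw with w ≟ f v
      ... | yes p = p
      -- Redirecting `v` to `w` is another choice of out-neighbours inside `C`, but as `f` is
      -- injective its image misses `f v`.
      ... | no w≢fv = ⊥-elim (absurd (onto h hC (f-∈ v∈C)))
        where
        h : Fin n → Fin n
        h x = if does (x ≟ v) then w else f x
        hC : ∀ x → x ∈ C → h x ∈ C × E x (h x)
        hC x x∈C with x ≟ v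
        ... | yes refl = w∈C , vw
        ... | no _ = fC x x∈C
        absurd : ¬ (∃ λ x → x ∈ C × h x ≡ f v)
        absurd (x , _ , eq) with x ≟ v
        ... | yes _ = w≢fv eq
        ... | no x≢v = x≢v (trans (sym (gf x)) (trans (cong g eq) (gf v)))
      prev-closed : ∀ {P : Fin n → Set} → (∀ v → Dec (P v)) → (∀ v → v ∈ C → P v → P (g v)) →
        ∀ {v} → v ∈ C → P v → ∀ {w} → w ∈ C → P w
      prev-closed {P} P? step {v} v∈C Pv {w} w∈C with P? w
      ... | yes Pw = Pw
      -- The vertices of `C` where `P` fails are closed under `f`, so by minimality they would be
      -- all of `C`, including `v`.
      ... | no ¬Pw = ⊥-elim (proj₂ (∈⁻ (least Bad (proj₁ ∘ ∈⁻) self (w , ∈⁺ (w∈C , ¬Pw)) v∈C)) Pv)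
        where
        Bad : Subset n
        Bad = ⟪ (λ x → (x ∈? C) ×-dec ¬? (P? x)) ⟫
        self : Self E V Bad
        self = C⊆V ∘ proj₁ ∘ ∈⁻ , λ x x∈ → let x∈C , ¬Px = ∈⁻ x∈ in
          f x , ∈⁺ (f-∈ x∈C , λ Pfx → ¬Px (subst P (gf x) (step (f x) (f-∈ x∈C) Pfx))) , f-arc x∈C

-- Reductions in a minimal counterexample: closed subsets and contraction.

module Counterexample {n : ℕ} {E : Fin n → Fin n → Set} (E? : ∀ v w → Dec (E v w)) {V : Subset n}
  (smaller : Smaller V) (big : Big E V) (no-single : ∀ u → ¬ Single E V u) where

  pick : ∀ {v} → v ∈ V → ∀ xs {_ : True (length xs ≤? 14)} → ∃ λ w → w ∈ V × E v w × All (w ≢_) xs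
  pick v∈V xs {small} = big _ v∈V xs (toWitness small)

  -- A vertex outside S can always leave towards S avoiding u, so a singleton class of S is one of V.
  opaque
    no-closed-subset : ∀ S → S ⊂ V → Nonempty S → (∀ v w → v ∈ S → w ∈ V → E v w → w ∈ S) → ⊥
    no-closed-subset S (S⊆V , x , x∈V , x∉S) ne closed = go (smaller E? (S⊆V , x , x∈V , x∉S) ne bigS)
      where
      bigS : Big E S
      bigS v v∈S xs len = let w , w∈V , vw , new = big v (S⊆V v∈S) xs len
                          in w , closed v w v∈S w∈V vw , vw , new
      enlarge : ∀ {X} → Self E S X → Self E V X
      enlarge (X⊆S , nxt) = S⊆V ∘ X⊆S , nxt
      go : ∃ (Single E S) → ⊥
      go (u , u∈S , sepS) = no-single u (S⊆V u∈S , λ w w∈V w≢u → weaken (sepU w w∈V w≢u))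
        where
        -- The set around `u` is kept inside `S`, so that the other set can absorb vertices outside
        -- `S` and stay disjoint from it.
        SepU : Fin n → Set
        SepU w = ∃ λ X → ∃ λ Y → Self E V X × Self E V Y × Disjoint X Y × u ∈ X × w ∈ Y × X ⊆ S
        weaken : ∀ {w} → SepU w → Sep E V u w
        weaken (X , Y , sX , sY , d , u∈ , w∈ , _) = X , Y , sX , sY , d , u∈ , w∈
        sepU? : ∀ w → Dec (SepU w)
        sepU? w = anySubset? λ X → anySubset? λ Y → self? E? X ×-dec self? E? Y ×-dec
          disjoint? X Y ×-dec (u ∈? X) ×-dec (w ∈? Y) ×-dec (X ⊆? S)
        Bad : Subset n
        Bad = ⟪ (λ w → (w ∈? V) ×-dec ¬? (w ≟ u) ×-dec ¬? (sepU? w)) ⟫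
        inS : ∀ {w} → w ∈ S → w ≢ u → SepU w
        inS {w} w∈S w≢u = let X , Y , sX , sY , d , u∈ , w∈ = sepS w w∈S w≢u
                          in X , Y , enlarge sX , enlarge sY , d , u∈ , w∈ , proj₁ sX
        selfS : Self E V S
        selfS = S⊆V , λ v v∈S → let w , w∈ , vw , _ = bigS v v∈S [] z≤n in w , w∈ , vw
        sepU : ∀ w → w ∈ V → w ≢ u → SepU w
        sepU w w∈V w≢u with sepU? w
        ... | yes p = p
        ... | no ¬p with sink-or-self E? {V} Bad (proj₁ ∘ ∈⁻)
        -- `Bad` does not meet `S`, where every vertex other than `u` has `SepU`; if
        -- self-sustaining, it can serve as the second set opposite `S` itself.
        ...   | inj₂ selfBad = S , Bad , selfS , selfBad ,
                (λ v v∈S v∈Bad → let _ , v≢u , ¬q = ∈⁻ v∈Bad in ¬q (inS v∈S v≢u)) ,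
                u∈S , ∈⁺ (w∈V , w≢u , ¬p) , (λ z → z)
        ...   | inj₁ (s , s∈ , s-sink)
                with s∈V , s≢u , ¬q ← ∈⁻ s∈
                with t , t∈V , st , t≢u ∷ [] ← pick s∈V (u ∷ [])
                with sepU? t
        ...     | no ¬r = ⊥-elim (s-sink t (∈⁺ (t∈V , t≢u , ¬r)) st)
        ...     | yes (X , Y , sX , sY , d , u∈ , t∈ , X⊆S) with s ∈? S
        ...       | yes s∈S = ⊥-elim (¬q (inS s∈S s≢u))
        ...       | no s∉S = ⊥-elim (¬q (X , add s Y , sX , self-add E? sY s∈V t∈ st , d′ , u∈ , ∈⁺ (inj₂ refl) , X⊆S))
          where
          d′ : Disjoint X (add s Y)
          d′ v v∈X v∈ with ∈⁻ v∈
          ... | inj₁ v∈Y = d v v∈X v∈Y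
          ... | inj₂ refl = s∉S (X⊆S v∈X)

  -- Contracting the arc c → y to y keeps all out-degrees when no vertex dominates both ends.
  opaque
    contract : ∀ {c y} → c ∈ V → y ∈ V → c ≢ y → E c y → (∀ z → z ∈ V → E z c → ¬ E z y) →
      ∃ λ u → u ∈ V × (∀ w → w ∈ V → w ≢ u → (w ≡ c → u ≢ y) → Sep E V u w)
    contract {c} {y} c∈V y∈V c≢y cy undominated = u , proj₁ (∈⁻ u∈V′) , sep
      where
      -- Arcs into `c` are redirected to `y`. A digon on `c` and `y` turns into a loop at `y`, so
      -- loops have to be allowed.
      E′ : Fin n → Fin n → Set
      E′ v w = E v w ⊎ (w ≡ y × E v c)
      E′? : ∀ v w → Dec (E′ v w)
      E′? v w = E? v w ⊎-dec ((w ≟ y) ×-dec E? v c)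
      V′ : Subset n
      V′ = V ∖ c
      -- A vertex with an arc to `c` has none to `y`. Forbidding `y` after the contraction thus
      -- becomes forbidding `c` before it, and the list keeps its length.
      swap : Fin n → Fin n
      swap x = if does (x ≟ y) then c else x
      swap-y : swap y ≡ c
      swap-y with y ≟ y
      ... | yes _ = refl
      ... | no ¬p = ⊥-elim (¬p refl)
      swap-≢ : ∀ {w} → w ≢ y → ∀ {x} → w ≢ swap x → w ≢ x
      swap-≢ w≢y {x} w≢ with x ≟ y
      ... | yes refl = w≢y
      ... | no _ = w≢
      big′ : Big E′ V′
      big′ v v∈V′ xs len with v∈V , v≢c ← ∈⁻ v∈V′ with E? v c
      ... | no ¬vc = let w , w∈V , vw , new = big v v∈V xs len
                     in w , ∈⁺ (w∈V , λ { refl → ¬vc vw }) , inj₁ vw , new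
      ... | yes vc with Any.any? (y ≟_) xs
      ...   | no y∉xs = y , ∈⁺ (y∈V , c≢y ∘ sym) , inj₂ (refl , vc) , All.¬Any⇒All¬ xs y∉xs
      ...   | yes y∈xs
              with w , w∈V , vw , new ← big v v∈V (map swap xs) (subst (_≤ 14) (sym (length-map swap xs)) len)
              = w , ∈⁺ (w∈V , λ w≡c → All.lookupWith (λ { w≢ refl → w≢ (trans w≡c (sym swap-y)) }) (All.map⁻ new) y∈xs)
                , inj₁ vw , All.map (swap-≢ λ { refl → undominated v v∈V vc vw }) (All.map⁻ new)
      found : ∃ (Single E′ V′)
      found = smaller E′? (∖-⊂ c∈V) (y , ∈⁺ (y∈V , c≢y ∘ sym)) big′
      u : Fin n
      u = proj₁ found
      u∈V′ : u ∈ V′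
      u∈V′ = proj₁ (proj₂ found)
      -- Undoing the contraction: `c` joins the set that contains `y` and uses the arc `c → y`. Only
      -- the pair of `u = y` and `w = c` cannot be separated in this way.
      lift : Subset n → Subset n
      lift S = ⟪ (λ x → (x ∈? S) ⊎-dec ((x ≟ c) ×-dec (y ∈? S))) ⟫
      lift-self : ∀ {S} → Self E′ V′ S → Self E V (lift S)
      lift-self {S} (S⊆V′ , nxt) = within , next
        where
        within : lift S ⊆ V
        within x∈ with ∈⁻ x∈
        ... | inj₁ x∈S = proj₁ (∈⁻ (S⊆V′ x∈S))
        ... | inj₂ (refl , _) = c∈V
        next : ∀ x → x ∈ lift S → ∃ λ w → w ∈ lift S × E x w
        next x x∈ with ∈⁻ x∈
        ... | inj₂ (refl , y∈S) = y , ∈⁺ (inj₁ y∈S) , cy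
        ... | inj₁ x∈S with nxt x x∈S
        ...   | w , w∈S , inj₁ xw = w , ∈⁺ (inj₁ w∈S) , xw
        ...   | w , w∈S , inj₂ (refl , xc) = c , ∈⁺ (inj₂ (refl , w∈S)) , xc
      lift-disjoint : ∀ {S S′} → S ⊆ V′ → S′ ⊆ V′ → Disjoint S S′ → Disjoint (lift S) (lift S′)
      lift-disjoint S⊆ S′⊆ d v v∈ v∈′ with ∈⁻ v∈ | ∈⁻ v∈′
      ... | inj₁ p | inj₁ q = d v p q
      ... | inj₁ p | inj₂ (refl , _) = proj₂ (∈⁻ (S⊆ p)) refl
      ... | inj₂ (refl , _) | inj₁ q = proj₂ (∈⁻ (S′⊆ q)) refl
      ... | inj₂ (_ , p) | inj₂ (_ , q) = d y p q
      sep : ∀ w → w ∈ V → w ≢ u → (w ≡ c → u ≢ y) → Sep E V u w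
      sep w w∈V w≢u ok with w ≟ c
      ... | no w≢c = let S , S′ , s , s′ , d , u∈ , w∈ = proj₂ (proj₂ found) w (∈⁺ (w∈V , w≢c)) w≢u
                     in lift S , lift S′ , lift-self s , lift-self s′ , lift-disjoint (proj₁ s) (proj₁ s′) d ,
                        ∈⁺ (inj₁ u∈) , ∈⁺ (inj₁ w∈)
      ... | yes refl = let S , S′ , s , s′ , d , u∈ , y∈ = proj₂ (proj₂ found) y (∈⁺ (y∈V , c≢y ∘ sym)) (ok refl ∘ sym)
                       in lift S , lift S′ , lift-self s , lift-self s′ , lift-disjoint (proj₁ s) (proj₁ s′) d ,
                          ∈⁺ (inj₁ u∈) , ∈⁺ (inj₂ (refl , y∈))

  dominator? : ∀ c y → Dec (∃ λ z → z ∈ V × E z c × E z y)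
  dominator? c y = any? λ z → (z ∈? V) ×-dec E? z c ×-dec E? z y

  opaque
    -- Otherwise contracting `c → y` produces a singleton class: the one pair that contraction
    -- leaves open, `y` and `c`, is separated by assumption.
    dominated : ∀ {c y} → c ∈ V → y ∈ V → c ≢ y → Sep E V y c → E c y → ∃ λ z → z ∈ V × E z c × E z y
    dominated {c} {y} c∈V y∈V c≢y y|c cy with dominator? c y
    ... | yes p = p
    ... | no ¬p with u , u∈V , sep ← contract c∈V y∈V c≢y cy (λ z z∈V zc zy → ¬p (z , z∈V , zc , zy))
        = ⊥-elim (no-single u (u∈V , λ w w∈V w≢u → sep′ w w∈V w≢u (w ≟ c) (u ≟ y)))
      where
      sep′ : ∀ w → w ∈ V → w ≢ u → Dec (w ≡ c) → Dec (u ≡ y) → Sep E V u w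
      sep′ w w∈V w≢u (yes refl) (yes refl) = y|c
      sep′ w w∈V w≢u (no w≢c) _ = sep w w∈V w≢u (⊥-elim ∘ w≢c)
      sep′ w w∈V w≢u _ (no u≢y) = sep w w∈V w≢u (λ _ → u≢y)

  -- Disjoint routes through an acyclic set down to its core.

  module Tokens (A C : Subset n) (A⊆V : A ⊆ V)
    (stays : ∀ {v w} → v ∈ A → v ∉ C → w ∈ V → E v w → w ∈ A)
    (acyclic : Acyclic E V ⟪ (λ v → (v ∈? A) ×-dec ¬? (v ∈? C)) ⟫) where

    -- Self-sustaining except on `C`, where routes may stop. The out-neighbours of core vertices are
    -- supplied later, in `flow⇒self` and `assemble`.
    Flow : Subset n → Set
    Flow S = S ⊆ A × (∀ v → v ∈ S → v ∉ C → ∃ λ w → w ∈ S × E v w)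

    K : Subset n
    K = ⟪ (λ v → (v ∈? A) ×-dec ¬? (v ∈? C)) ⟫

    ranked : ∃ λ (ρ : Fin n → ℕ) → ∀ v w → v ∈ K → w ∈ K → E v w → ρ w < ρ v
    ranked = rank E? acyclic (A⊆V ∘ proj₁ ∘ ∈⁻)

    opaque
      r : Fin n → ℕ
      r v with v ∈? C
      ... | yes _ = 0
      ... | no _ = suc (proj₁ ranked v)

      r↓ : ∀ {v w} → v ∈ A → v ∉ C → w ∈ A → E v w → r w < r v
      r↓ {v} {w} v∈A v∉C w∈A vw with v ∈? C | w ∈? C
      ... | yes p | _ = ⊥-elim (v∉C p)
      ... | no _ | yes _ = s≤s z≤n
      ... | no _ | no w∉C = s≤s (proj₂ ranked v w (∈⁺ (v∈A , v∉C)) (∈⁺ (w∈A , w∉C)) vw)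

      r-C : ∀ {v} → v ∈ C → r v ≡ 0
      r-C {v} v∈C with v ∈? C
      ... | yes _ = refl
      ... | no ¬p = ⊥-elim (¬p v∈C)

      r-0 : ∀ {v} → r v ≤ 0 → v ∈ C
      r-0 {v} rv≤0 with v ∈? C
      ... | yes p = p
      r-0 {v} () | no _

    -- The invariant of `split`: apart from the tokens, the sets lie strictly below any bound on the
    -- token ranks. Applied with the rank that the top token had before its move, it keeps the
    -- vertex left behind out of the opposite set.
    Within : ℕ → Fin n → Fin n → Fin n → Subset n → Subset n → Set
    Within m u w w′ S S′ =
      (∀ x → x ∈ S → x ≡ u ⊎ r x < m) × (∀ x → x ∈ S′ → (x ≡ w ⊎ x ≡ w′) ⊎ r x < m)

    Split : Fin n → Fin n → Fin n → Set
    Split u w w′ = ∃ λ S → ∃ λ S′ → Flow S × Flow S′ × Disjoint S S′ × u ∈ S × w ∈ S′ × w′ ∈ S′ ×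
      (∀ m → r u ≤ m → r w ≤ m → r w′ ≤ m → Within m u w w′ S S′)

    flow-add : ∀ {S v w} → Flow S → v ∈ A → w ∈ S → E v w → Flow (add v S)
    flow-add {S} {v} {w} (S⊆A , nxt) v∈A w∈S vw = within , next
      where
      within : add v S ⊆ A
      within x∈ with ∈⁻ x∈
      ... | inj₁ x∈S = S⊆A x∈S
      ... | inj₂ refl = v∈A
      next : ∀ x → x ∈ add v S → x ∉ C → ∃ λ y → y ∈ add v S × E x y
      next x x∈ x∉C with ∈⁻ x∈
      ... | inj₁ x∈S = let y , y∈S , xy = nxt x x∈S x∉C in y , ∈⁺ (inj₁ y∈S) , xy
      ... | inj₂ refl = w , ∈⁺ (inj₁ w∈S) , vw

    swap-split : ∀ {u w w′} → Split u w w′ → Split u w′ w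
    swap-split (S , S′ , f , f′ , d , u∈ , w∈ , w′∈ , within) =
      S , S′ , f , f′ , d , u∈ , w′∈ , w∈ , λ m u≤ w′≤ w≤ → let a , b = within m u≤ w≤ w′≤ in a , λ x x∈ → flip⊎ (b x x∈)
      where
      flip⊎ : ∀ {P Q R : Set} → (P ⊎ Q) ⊎ R → (Q ⊎ P) ⊎ R
      flip⊎ (inj₁ (inj₁ p)) = inj₁ (inj₂ p)
      flip⊎ (inj₁ (inj₂ q)) = inj₁ (inj₁ q)
      flip⊎ (inj₂ r) = inj₂ r

    terminal : ∀ {u w w′} → u ∈ A → w ∈ A → w′ ∈ A → u ≢ w → u ≢ w′ → u ∈ C → w ∈ C → w′ ∈ C → Split u w w′
    terminal {u} {w} {w′} u∈A w∈A w′∈A u≢w u≢w′ u∈C w∈C w′∈C =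
      ⟪ _≟ u ⟫ , ⟪ (λ x → (x ≟ w) ⊎-dec (x ≟ w′)) ⟫ ,
      ((λ x∈ → subst (_∈ A) (sym (∈⁻ x∈)) u∈A) , λ v v∈ v∉C → ⊥-elim (v∉C (subst (_∈ C) (sym (∈⁻ v∈)) u∈C))) ,
      ((λ x∈ → two w∈A w′∈A (∈⁻ x∈)) , λ v v∈ v∉C → ⊥-elim (v∉C (two w∈C w′∈C (∈⁻ v∈)))) ,
      (λ v v∈ v∈′ → apart (∈⁻ v∈) (∈⁻ v∈′)) ,
      ∈⁺ refl , ∈⁺ (inj₁ refl) , ∈⁺ (inj₂ refl) , λ m _ _ _ → (λ x x∈ → inj₁ (∈⁻ x∈)) , λ x x∈ → inj₁ (∈⁻ x∈)
      where
      two : ∀ {B : Subset n} {x} → w ∈ B → w′ ∈ B → x ≡ w ⊎ x ≡ w′ → x ∈ B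
      two p q (inj₁ refl) = p
      two p q (inj₂ refl) = q
      apart : ∀ {v} → v ≡ u → ¬ (v ≡ w ⊎ v ≡ w′)
      apart refl (inj₁ eq) = u≢w eq
      apart refl (inj₂ eq) = u≢w′ eq

    -- Always advancing a token of highest rank, it never meets the past of another token.
    opaque
      split : ∀ {u w w′} → u ∈ A → w ∈ A → w′ ∈ A → u ≢ w → u ≢ w′ → Split u w w′
      split {u} {w} {w′} u∈A w∈A w′∈A u≢w u≢w′ = go _ ≤-refl u∈A w∈A w′∈A u≢w u≢w′
        where
        go : ∀ m {u w w′} → r u + (r w + r w′) < m → u ∈ A → w ∈ A → w′ ∈ A → u ≢ w → u ≢ w′ → Split u w w′
        moveW : ∀ m {u w w′} → r u + (r w + r w′) < suc m → r u ≤ r w → r w′ ≤ r w →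
          u ∈ A → w ∈ A → w′ ∈ A → u ≢ w → u ≢ w′ → w ∉ C → Split u w w′
        moveW m {u} {w} {w′} lt u≤w w′≤w u∈A w∈A w′∈A u≢w u≢w′ w∉C
          -- Only `u` is forbidden: `w` and `w′` end up in the same set, so their tokens may meet.
          with w₂ , w₂∈V , ww₂ , w₂≢u ∷ [] ← pick (A⊆V w∈A) (u ∷ [])
          with w₂<w ← r↓ w∈A w∉C (stays w∈A w∉C w₂∈V ww₂) ww₂
          with S , S′ , f , f′ , d , u∈ , w₂∈ , w′∈ , within ←
            go m (<-≤-trans (+-monoʳ-< (r u) (+-monoˡ-< (r w′) w₂<w)) (≤-pred lt))
              u∈A (stays w∈A w∉C w₂∈V ww₂) w′∈A (w₂≢u ∘ sym) u≢w′
          = S , add w S′ , f , flow-add f′ w∈A w₂∈ ww₂ , d′ , u∈ , ∈⁺ (inj₂ refl) , ∈⁺ (inj₁ w′∈) , within′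
          where
          d′ : Disjoint S (add w S′)
          d′ x x∈S x∈ with ∈⁻ x∈
          ... | inj₁ x∈S′ = d x x∈S x∈S′
          ... | inj₂ refl with proj₁ (within (r w) u≤w (<⇒≤ w₂<w) w′≤w) w x∈S
          ...   | inj₁ eq = u≢w (sym eq)
          ...   | inj₂ lt′ = n≮n _ lt′
          within′ : ∀ m → r u ≤ m → r w ≤ m → r w′ ≤ m → Within m u w w′ S (add w S′)
          within′ m u≤m w≤m w′≤m = proj₁ old , new
            where
            old : Within m u w₂ w′ S S′
            old = within m u≤m (≤-trans (<⇒≤ w₂<w) w≤m) w′≤m
            new : ∀ x → x ∈ add w S′ → (x ≡ w ⊎ x ≡ w′) ⊎ r x < m
            new x x∈ with ∈⁻ x∈
            ... | inj₂ eq = inj₁ (inj₁ eq)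
            ... | inj₁ x∈S′ with proj₂ old x x∈S′
            ...   | inj₁ (inj₁ refl) = inj₂ (<-≤-trans w₂<w w≤m)
            ...   | inj₁ (inj₂ eq) = inj₁ (inj₂ eq)
            ...   | inj₂ lt′ = inj₂ lt′
        moveU : ∀ m {u w w′} → r u + (r w + r w′) < suc m → r w ≤ r u → r w′ ≤ r u →
          u ∈ A → w ∈ A → w′ ∈ A → u ≢ w → u ≢ w′ → u ∉ C → Split u w w′
        moveU m {u} {w} {w′} lt w≤u w′≤u u∈A w∈A w′∈A u≢w u≢w′ u∉C
          with u₂ , u₂∈V , uu₂ , u₂≢w ∷ u₂≢w′ ∷ [] ← pick (A⊆V u∈A) (w ∷ w′ ∷ [])
          with u₂<u ← r↓ u∈A u∉C (stays u∈A u∉C u₂∈V uu₂) uu₂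
          with S , S′ , f , f′ , d , u₂∈ , w∈ , w′∈ , within ←
            go m (<-≤-trans (+-monoˡ-< (r w + r w′) u₂<u) (≤-pred lt))
              (stays u∈A u∉C u₂∈V uu₂) w∈A w′∈A u₂≢w u₂≢w′
          = add u S , S′ , flow-add f u∈A u₂∈ uu₂ , f′ , d′ , ∈⁺ (inj₂ refl) , w∈ , w′∈ , within′
          where
          d′ : Disjoint (add u S) S′
          d′ x x∈ x∈S′ with ∈⁻ x∈
          ... | inj₁ x∈S = d x x∈S x∈S′
          ... | inj₂ refl with proj₂ (within (r u) (<⇒≤ u₂<u) w≤u w′≤u) u x∈S′
          ...   | inj₁ (inj₁ eq) = u≢w eq
          ...   | inj₁ (inj₂ eq) = u≢w′ eq
          ...   | inj₂ lt′ = n≮n _ lt′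
          within′ : ∀ m → r u ≤ m → r w ≤ m → r w′ ≤ m → Within m u w w′ (add u S) S′
          within′ m u≤m w≤m w′≤m = new , proj₂ old
            where
            old : Within m u₂ w w′ S S′
            old = within m (≤-trans (<⇒≤ u₂<u) u≤m) w≤m w′≤m
            new : ∀ x → x ∈ add u S → x ≡ u ⊎ r x < m
            new x x∈ with ∈⁻ x∈
            ... | inj₂ eq = inj₁ eq
            ... | inj₁ x∈S with proj₁ old x x∈S
            ...   | inj₁ refl = inj₂ (<-≤-trans u₂<u u≤m)
            ...   | inj₂ lt′ = inj₂ lt′
        go (suc m) {u} {w} {w′} lt u∈A w∈A w′∈A u≢w u≢w′ = choose (≤-total (r u) (r w)) (≤-total (r u) (r w′)) (≤-total (r w) (r w′))
          where
          topU : r w ≤ r u → r w′ ≤ r u → Split u w w′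
          topU w≤u w′≤u with u ∈? C
          ... | no u∉C = moveU m lt w≤u w′≤u u∈A w∈A w′∈A u≢w u≢w′ u∉C
          -- `r` vanishes exactly on `C`, so once the top token is in `C` all three are.
          ... | yes u∈C = terminal u∈A w∈A w′∈A u≢w u≢w′ u∈C
                  (r-0 (subst (r w ≤_) (r-C u∈C) w≤u)) (r-0 (subst (r w′ ≤_) (r-C u∈C) w′≤u))
          topW : r u ≤ r w → r w′ ≤ r w → Split u w w′
          topW u≤w w′≤w with w ∈? C
          ... | no w∉C = moveW m lt u≤w w′≤w u∈A w∈A w′∈A u≢w u≢w′ w∉C
          ... | yes w∈C = terminal u∈A w∈A w′∈A u≢w u≢w′
                  (r-0 (subst (r u ≤_) (r-C w∈C) u≤w)) w∈C (r-0 (subst (r w′ ≤_) (r-C w∈C) w′≤w))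
          topW′ : r u ≤ r w′ → r w ≤ r w′ → Split u w w′
          topW′ u≤w′ w≤w′ with w′ ∈? C
          ... | no w′∉C = swap-split (moveW m (subst (λ z → r u + z < suc m) (+-comm (r w) (r w′)) lt) u≤w′ w≤w′
                            u∈A w′∈A w∈A u≢w′ u≢w w′∉C)
          ... | yes w′∈C = terminal u∈A w∈A w′∈A u≢w u≢w′
                  (r-0 (subst (r u ≤_) (r-C w′∈C) u≤w′)) (r-0 (subst (r w ≤_) (r-C w′∈C) w≤w′)) w′∈C
          choose : r u ≤ r w ⊎ r w ≤ r u → r u ≤ r w′ ⊎ r w′ ≤ r u → r w ≤ r w′ ⊎ r w′ ≤ r w → Split u w w′
          choose (inj₂ w≤u) (inj₂ w′≤u) _ = topU w≤u w′≤u
          choose (inj₁ u≤w) _ (inj₂ w′≤w) = topW u≤w w′≤w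
          choose _ (inj₁ u≤w′) (inj₁ w≤w′) = topW′ u≤w′ w≤w′
          choose (inj₂ w≤u) (inj₁ u≤w′) (inj₂ w′≤w) = topW (≤-trans u≤w′ w′≤w) w′≤w
          choose (inj₁ u≤w) (inj₂ w′≤u) (inj₁ w≤w′) = topW′ (≤-trans u≤w w≤w′) w≤w′

-- Some pair of vertices is separated.

module Existence {n : ℕ} {E : Fin n → Fin n → Set} (E? : ∀ v w → Dec (E v w)) {V : Subset n}
  (smaller : Smaller V) (big : Big E V) (no-single : ∀ u → ¬ Single E V u)
  (V≠∅ : Nonempty V) (no-sep : ∀ u w → ¬ Sep E V u w) where

  open Counterexample E? smaller big no-single

  V-self : Self E V V
  V-self = (λ x → x) , λ v v∈V → let w , w∈V , vw , _ = pick v∈V [] in w , w∈V , vw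

  opaque
    core : ∃ λ C → C ⊆ V × Minimal E V C
    core = minimal E? V V-self V≠∅

  C : Subset n
  C = proj₁ core

  C-self : Self E V C
  C-self = proj₁ (proj₂ (proj₂ core))

  C⊆V : C ⊆ V
  C⊆V = proj₁ C-self

  c₀ : Fin n
  c₀ = proj₁ (proj₁ (proj₂ (proj₂ (proj₂ core))))

  c₀∈C : c₀ ∈ C
  c₀∈C = proj₂ (proj₁ (proj₂ (proj₂ (proj₂ core))))

  open Cycle (cycle E? (proj₂ (proj₂ core)))

  K : Subset n
  K = ⟪ (λ v → (v ∈? V) ×-dec ¬? (v ∈? C)) ⟫

  K-acyclic : Acyclic E V K
  K-acyclic X X⊆K X-self v v∈X =
    no-sep v c₀ (X , C , X-self , C-self , (λ w w∈X w∈C → proj₂ (∈⁻ (X⊆K w∈X)) w∈C) , v∈X , c₀∈C)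

  dom : ∀ {c y} → c ∈ V → y ∈ V → c ≢ y → E c y → ∃ λ z → z ∈ V × E z c × E z y
  dom {c} {y} c∈V y∈V c≢y cy with dominator? c y
  ... | yes p = p
  ... | no ¬p with u , u∈V , sep ← contract c∈V y∈V c≢y cy (λ z z∈V zc zy → ¬p (z , z∈V , zc , zy))
              with w , w∈V , _ , w≢u ∷ w≢c ∷ [] ← pick u∈V (u ∷ c ∷ [])
      = ⊥-elim (no-sep u w (sep w w∈V w≢u (⊥-elim ∘ w≢c)))

  -- The pair and its complement would both be self-sustaining, since every vertex has an
  -- out-neighbour avoiding `c` and `y`.
  no-digon : ∀ {c y} → c ∈ V → y ∈ V → E c y → ¬ E y c
  no-digon {c} {y} c∈V y∈V cy yc with w , w∈V , _ , w≢c ∷ w≢y ∷ [] ← pick c∈V (c ∷ y ∷ []) =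
    no-sep c w (⟪ in? ⟫ , ⟪ (λ x → (x ∈? V) ×-dec ¬? (in? x)) ⟫ , ((λ x∈ → within (∈⁻ x∈)) , λ x x∈ → next′ (∈⁻ x∈)) ,
      (proj₁ ∘ ∈⁻ , λ x x∈ → case pick (proj₁ (∈⁻ x∈)) (c ∷ y ∷ []) of λ where
        (z , z∈V , xz , z≢c ∷ z≢y ∷ []) → z , ∈⁺ (z∈V , neither z≢c z≢y) , xz) ,
      (λ v v∈ v∈′ → proj₂ (∈⁻ v∈′) (∈⁻ v∈)) , ∈⁺ (inj₁ refl) , ∈⁺ (w∈V , neither w≢c w≢y))
    where
    in? : ∀ x → Dec (x ≡ c ⊎ x ≡ y)
    in? x = (x ≟ c) ⊎-dec (x ≟ y)
    within : ∀ {x} → x ≡ c ⊎ x ≡ y → x ∈ V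
    within (inj₁ refl) = c∈V
    within (inj₂ refl) = y∈V
    next′ : ∀ {x} → x ≡ c ⊎ x ≡ y → ∃ λ z → z ∈ ⟪ in? ⟫ × E x z
    next′ (inj₁ refl) = y , ∈⁺ (inj₂ refl) , cy
    next′ (inj₂ refl) = c , ∈⁺ (inj₁ refl) , yc
    neither : ∀ {x} → x ≢ c → x ≢ y → ¬ (x ≡ c ⊎ x ≡ y)
    neither x≢c x≢y (inj₁ eq) = x≢c eq
    neither x≢c x≢y (inj₂ eq) = x≢y eq

  has-in : ∀ {x} → x ∈ V → ∃ λ z → z ∈ V × E z x
  has-in {x} x∈V with any? (λ z → (z ∈? V) ×-dec E? z x)
  ... | yes p = p
  ... | no ¬p with w , w∈V , _ , w≢x ∷ [] ← pick x∈V (x ∷ []) =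
    ⊥-elim (no-closed-subset (V ∖ x) (∖-⊂ x∈V) (w , ∈⁺ (w∈V , w≢x))
      λ v w v∈ w∈V vw → ∈⁺ (w∈V , λ { refl → ¬p (v , proj₁ (∈⁻ v∈) , vw) }))

  opaque
    ranked : ∃ λ (ρ : Fin n → ℕ) → ∀ v w → v ∈ K → w ∈ K → E v w → ρ w < ρ v
    ranked = rank E? K-acyclic (proj₁ ∘ ∈⁻)

  ρ : Fin n → ℕ
  ρ = proj₁ ranked

  K-neighbour : ∀ y → ∃ λ x → x ∈ K × x ≢ y
  K-neighbour y with x , x∈V , cx , x≢next ∷ x≢y ∷ [] ← pick (C⊆V c₀∈C) (next c₀ ∷ y ∷ []) =
    x , ∈⁺ (x∈V , λ x∈C → x≢next (chordless c₀∈C x∈C cx)) , x≢y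

  opaque
    first : ∃ λ y → y ∈ K × (∀ x → x ∈ K → ρ x ≤ ρ y)
    first = argmax ρ K (let x , x∈K , _ = K-neighbour c₀ in x , x∈K)

  y : Fin n
  y = proj₁ first

  y∈K : y ∈ K
  y∈K = proj₁ (proj₂ first)

  opaque
    second : ∃ λ y₂ → y₂ ∈ K ∖ y × (∀ x → x ∈ K ∖ y → ρ x ≤ ρ y₂)
    second = argmax ρ (K ∖ y) (let x , x∈K , x≢y = K-neighbour y in x , ∈⁺ (x∈K , x≢y))

  y₂ : Fin n
  y₂ = proj₁ second

  y₂∈K : y₂ ∈ K
  y₂∈K = proj₁ (∈⁻ (proj₁ (proj₂ second)))

  y₂≢y : y₂ ≢ y
  y₂≢y = proj₂ (∈⁻ (proj₁ (proj₂ second)))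

  K⊆V : K ⊆ V
  K⊆V x∈K = proj₁ (∈⁻ x∈K)

  C≢K : ∀ {c x} → c ∈ C → x ∈ K → c ≢ x
  C≢K c∈C x∈K refl = proj₂ (∈⁻ x∈K) c∈C

  into-y : ∀ {z} → z ∈ V → E z y → z ∈ C
  into-y {z} z∈V zy with z ∈? C
  ... | yes z∈C = z∈C
  ... | no z∉C = ⊥-elim (n≮n _ (<-≤-trans (proj₂ ranked z y (∈⁺ (z∈V , z∉C)) y∈K zy)
                   (proj₂ (proj₂ first) z (∈⁺ (z∈V , z∉C)))))

  into-y₂ : ∀ {z} → z ∈ V → E z y₂ → z ∈ C ⊎ z ≡ y
  into-y₂ {z} z∈V zy₂ with z ∈? C | z ≟ y
  ... | yes z∈C | _ = inj₁ z∈C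
  ... | no _ | yes z≡y = inj₂ z≡y
  ... | no z∉C | no z≢y = ⊥-elim (n≮n _ (<-≤-trans (proj₂ ranked z y₂ (∈⁺ (z∈V , z∉C)) y₂∈K zy₂)
                   (proj₂ (proj₂ second) z (∈⁺ (∈⁺ (z∈V , z∉C) , z≢y)))))

  prev-of : ∀ {z c} → z ∈ C → c ∈ C → E z c → prev c ≡ z
  prev-of z∈C c∈C zc = trans (cong prev (chordless z∈C c∈C zc)) (prev-next _)

  -- Having top rank in `K`, `y` receives arcs from `C` only. The common in-neighbour of `c` and `y`
  -- is therefore on the cycle and must be `prev c`, so arcs to `y` spread backwards around `C`.
  all-y : ∀ {c} → c ∈ C → E c y
  all-y = let z , z∈V , zy = has-in (K⊆V y∈K) in prev-closed (λ c → E? c y) step (into-y z∈V zy) zy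
    where
    step : ∀ c → c ∈ C → E c y → E (prev c) y
    step c c∈C cy with z , z∈V , zc , zy ← dom (C⊆V c∈C) (K⊆V y∈K) (C≢K c∈C y∈K) cy =
      subst (λ x → E x y) (sym (prev-of (into-y z∈V zy) c∈C zc)) zy

  some-y₂ : ∃ λ c → c ∈ C × E c y₂
  some-y₂ with z , z∈V , zy₂ ← has-in (K⊆V y₂∈K) with into-y₂ z∈V zy₂
  ... | inj₁ z∈C = z , z∈C , zy₂
  -- If the in-neighbour found is `y`, a common in-neighbour of `y` and `y₂` serves instead: it
  -- sends an arc to `y`, so it lies on `C`.
  ... | inj₂ refl = let x , x∈V , xy , xy₂ = dom (K⊆V y∈K) (K⊆V y₂∈K) (y₂≢y ∘ sym) zy₂
                    in x , into-y x∈V xy , xy₂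

  -- As for `all-y`, except that the common in-neighbour may now be `y`, the only vertex of `K` that
  -- can have an arc to `y₂`; this would create a digon on `c` and `y`.
  all-y₂ : ∀ {c} → c ∈ C → E c y₂
  all-y₂ = let z , z∈C , zy₂ = some-y₂ in prev-closed (λ c → E? c y₂) step z∈C zy₂
    where
    step : ∀ c → c ∈ C → E c y₂ → E (prev c) y₂
    step c c∈C cy₂ with z , z∈V , zc , zy₂ ← dom (C⊆V c∈C) (K⊆V y₂∈K) (C≢K c∈C y₂∈K) cy₂ with into-y₂ z∈V zy₂
    ... | inj₁ z∈C = subst (λ x → E x y₂) (sym (prev-of z∈C c∈C zc)) zy₂
    ... | inj₂ refl = ⊥-elim (no-digon (C⊆V c∈C) z∈V (all-y c∈C) zc)

  open Tokens V C (λ x → x) (λ _ _ w∈V _ → w∈V) K-acyclic using (Flow; split)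

  flow⇒self : ∀ {S x} → Flow S → x ∈ S → (∀ {c} → c ∈ C → E c x) → Self E V S
  flow⇒self {S} {x} (S⊆V , nxt) x∈S all = S⊆V , λ v v∈S → case v ∈? C of λ where
    (yes v∈C) → x , x∈S , all v∈C
    (no v∉C) → nxt v v∈S v∉C

  absurd : ⊥
  -- The third token repeats the second. All of `C` has arcs to both `y` and `y₂`, so the two
  -- disjoint flows are self-sustaining.
  absurd with S , S′ , f , f′ , d , y∈S , y₂∈S′ , _ ← split (K⊆V y∈K) (K⊆V y₂∈K) (K⊆V y₂∈K) (y₂≢y ∘ sym) (y₂≢y ∘ sym) =
    no-sep y y₂ (S , S′ , flow⇒self f y∈S all-y , flow⇒self f′ y₂∈S′ all-y₂ , d , y∈S , y₂∈S′)

-- Distributing all vertices among the members of a maximum packing.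

module Labelling {n : ℕ} {E : Fin n → Fin n → Set} (E? : ∀ v w → Dec (E v w)) {V : Subset n}
  (smaller : Smaller V) (big : Big E V) (no-single : ∀ u → ¬ Single E V u)
  {k : ℕ} (i₀ : Fin k) (P : Packing E V k) (no-larger : ¬ Packing E V (suc k)) where

  open Counterexample E? smaller big no-single
  open Packing P

  rest : Subset n
  rest = ⟪ (λ v → (v ∈? V) ×-dec ¬? (any? λ i → v ∈? C i)) ⟫

  rest-acyclic : Acyclic E V rest
  rest-acyclic X X⊆rest X-self v v∈X = no-larger record
    { C = C′ ; self = λ { zero → X-self ; (suc i) → self i } ; inhab = λ { zero → v , v∈X ; (suc i) → inhab i }
    ; disjoint = λ {i} {j} → disjoint′ i j }
    where
    C′ : Fin (suc k) → Subset n
    C′ zero = X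
    C′ (suc i) = C i
    disjoint′ : ∀ i j {v} → v ∈ C′ i → v ∈ C′ j → i ≡ j
    disjoint′ zero zero _ _ = refl
    disjoint′ zero (suc j) p q = ⊥-elim (proj₂ (∈⁻ (X⊆rest p)) (j , q))
    disjoint′ (suc i) zero p q = ⊥-elim (proj₂ (∈⁻ (X⊆rest q)) (i , p))
    disjoint′ (suc i) (suc j) p q = cong suc (disjoint p q)

  -- The vertices outside Todo are labelled.
  record Valid (Todo : Subset n) (lab : Fin n → Fin k) : Set where
    field
      todo   : Todo ⊆ rest
      lab-C  : ∀ {i v} → v ∈ C i → lab v ≡ i
      settled : ∀ {v w} → v ∈ rest → v ∉ Todo → w ∈ V → E v w → w ∉ Todo × lab w ≡ lab v

  -- Such an `s` would be a singleton class: every other vertex lies in a self-sustaining set that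
  -- avoids `s` and one of the two parts that `s` points to, and `s` joins the part avoided.
  module Ambiguous {Todo lab} (valid : Valid Todo lab) {s} (s∈ : s ∈ Todo) (s-sink : ∀ w → w ∈ Todo → ¬ E s w)
    {x₁ x₂} (x₁∈V : x₁ ∈ V) (x₂∈V : x₂ ∈ V) (sx₁ : E s x₁) (sx₂ : E s x₂) (x₁≢x₂ : lab x₁ ≢ lab x₂) where

    open Valid valid

    s∈V : s ∈ V
    s∈V = proj₁ (∈⁻ (todo s∈))

    Part : Fin k → Subset n
    Part i = ⟪ (λ v → (v ∈? V) ×-dec ¬? (v ∈? Todo) ×-dec (lab v ≟ i)) ⟫

    C-labelled : ∀ {i v} → v ∈ C i → v ∉ Todo
    C-labelled v∈C v∈Todo = proj₂ (∈⁻ (todo v∈Todo)) (_ , v∈C)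

    part-self : ∀ i → Self E V (Part i)
    part-self i = proj₁ ∘ ∈⁻ , λ v v∈ → next v (∈⁻ v∈)
      where
      next : ∀ v → v ∈ V × v ∉ Todo × lab v ≡ i → ∃ λ w → w ∈ Part i × E v w
      next v (v∈V , v∉Todo , refl) with any? (λ j → v ∈? C j)
      ... | yes (j , v∈C) = let w , w∈C , vw = proj₂ (self j) v v∈C
                            in w , ∈⁺ (proj₁ (self j) w∈C , C-labelled w∈C , trans (lab-C w∈C) (sym (lab-C v∈C))) , vw
      ... | no v∉C = let w , w∈V , vw , _ = pick v∈V []
                         w∉Todo , eq = settled (∈⁺ (v∈V , v∉C)) v∉Todo w∈V vw
                     in w , ∈⁺ (w∈V , w∉Todo , eq) , vw

    Avoid : Fin n → Fin k → Set
    Avoid w i = ∃ λ S → Self E V S × Disjoint (add s (Part i)) S × w ∈ S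

    avoid? : ∀ w → Dec (Avoid w (lab x₁) ⊎ Avoid w (lab x₂))
    avoid? w = dec (lab x₁) ⊎-dec dec (lab x₂)
      where
      dec : ∀ i → Dec (Avoid w i)
      dec i = anySubset? λ S → self? E? S ×-dec disjoint? (add s (Part i)) S ×-dec (w ∈? S)

    labelled-avoids : ∀ {w} → w ∈ V → w ∉ Todo → Avoid w (lab x₁) ⊎ Avoid w (lab x₂)
    labelled-avoids {w} w∈V w∉Todo with lab w ≟ lab x₁
    ... | no w≢x₁ = inj₁ (Part (lab w) , part-self _ , apart w≢x₁ , ∈⁺ (w∈V , w∉Todo , refl))
      where
      apart : ∀ {i j} → i ≢ j → Disjoint (add s (Part j)) (Part i)
      apart i≢j v v∈ v∈′ with ∈⁻ v∈
      ... | inj₁ p = i≢j (trans (sym (proj₂ (proj₂ (∈⁻ v∈′)))) (proj₂ (proj₂ (∈⁻ p))))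
      ... | inj₂ refl = proj₁ (proj₂ (∈⁻ v∈′)) s∈
    ... | yes w≡x₁ = inj₂ (Part (lab w) , part-self _ , apart , ∈⁺ (w∈V , w∉Todo , refl))
      where
      apart : Disjoint (add s (Part (lab x₂))) (Part (lab w))
      apart v v∈ v∈′ with ∈⁻ v∈
      ... | inj₁ p = x₁≢x₂ (trans (sym w≡x₁) (trans (sym (proj₂ (proj₂ (∈⁻ v∈′)))) (proj₂ (proj₂ (∈⁻ p)))))
      ... | inj₂ refl = proj₁ (proj₂ (∈⁻ v∈′)) s∈

    Bad : Subset n
    Bad = ⟪ (λ w → (w ∈? V) ×-dec ¬? (w ≟ s) ×-dec ¬? (avoid? w)) ⟫

    Bad⊆Todo : Bad ⊆ Todo
    Bad⊆Todo {w} w∈ with w ∈? Todo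
    ... | yes p = p
    ... | no w∉Todo = ⊥-elim (proj₂ (proj₂ (∈⁻ w∈)) (labelled-avoids (proj₁ (∈⁻ w∈)) w∉Todo))

    avoid-step : ∀ {v w i} → v ∈ Todo → v ≢ s → E v w → Avoid w i → Avoid v i
    avoid-step {v} {w} {i} v∈Todo v≢s vw (S , S-self , d , w∈S) =
      add v S , self-add E? S-self (proj₁ (∈⁻ (todo v∈Todo))) w∈S vw , d′ , ∈⁺ (inj₂ refl)
      where
      d′ : Disjoint (add s (Part i)) (add v S)
      d′ x x∈ x∈′ with ∈⁻ x∈′
      ... | inj₁ x∈S = d x x∈ x∈S
      ... | inj₂ refl with ∈⁻ x∈
      ...   | inj₁ p = proj₁ (proj₂ (∈⁻ p)) v∈Todo
      ...   | inj₂ eq = v≢s eq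

    avoids : ∀ w → w ∈ V → w ≢ s → Avoid w (lab x₁) ⊎ Avoid w (lab x₂)
    avoids w w∈V w≢s with avoid? w
    ... | yes p = p
    ... | no ¬p
        with t , t∈ , t-sink ← sink E? rest-acyclic (todo ∘ Bad⊆Todo) (proj₁ ∘ ∈⁻) (∈⁺ {x = w} (w∈V , w≢s , ¬p))
        with t∈V , t≢s , ¬q ← ∈⁻ t∈
        with x , x∈V , tx , x≢s ∷ [] ← pick t∈V (s ∷ [])
        with avoid? x
    ...   | no ¬r = ⊥-elim (t-sink x (∈⁺ (x∈V , x≢s , ¬r)) tx)
    ...   | yes (inj₁ a) = ⊥-elim (¬q (inj₁ (avoid-step (Bad⊆Todo t∈) t≢s tx a)))
    ...   | yes (inj₂ a) = ⊥-elim (¬q (inj₂ (avoid-step (Bad⊆Todo t∈) t≢s tx a)))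

    join : ∀ {x w} → x ∈ V → E s x → Avoid w (lab x) → Sep E V s w
    join {x} x∈V sx (S , S-self , d , w∈S) = add s (Part (lab x)) , S ,
      self-add E? (part-self (lab x)) s∈V (∈⁺ {x = x} (x∈V , (λ x∈ → s-sink x x∈ sx) , refl)) sx , S-self , d ,
      ∈⁺ (inj₂ refl) , w∈S

    absurd : ⊥
    absurd = no-single s (s∈V , λ w w∈V w≢s → case avoids w w∈V w≢s of λ where
      (inj₁ a) → join x₁∈V sx₁ a
      (inj₂ a) → join x₂∈V sx₂ a)

  Labels : Set
  Labels = ∃ λ (lab : Fin n → Fin k) → (∀ {i v} → v ∈ C i → lab v ≡ i) ×
    (∀ {v w} → v ∈ rest → w ∈ V → E v w → lab w ≡ lab v)

  extend : ∀ {Todo lab s} → Valid Todo lab → s ∈ Todo → (∀ w → w ∈ Todo → ¬ E s w) →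
    ∃ λ lab′ → Valid (Todo ∖ s) lab′
  extend {Todo} {lab} {s} valid s∈ s-sink = lab′ , record
    { todo = todo ∘ proj₁ ∘ ∈⁻
    ; lab-C = λ v∈C → trans (lab′-≢ λ { refl → proj₂ (∈⁻ (todo s∈)) (_ , v∈C) }) (lab-C v∈C)
    ; settled = settled′ }
    where
    open Valid valid
    chosen : ∃ λ x → x ∈ V × E s x × All (x ≢_) []
    chosen = pick (proj₁ (∈⁻ (todo s∈))) []
    lab′ : Fin n → Fin k
    lab′ v = if does (v ≟ s) then lab (proj₁ chosen) else lab v
    lab′-≢ : ∀ {v} → v ≢ s → lab′ v ≡ lab v
    lab′-≢ {v} v≢s with v ≟ s
    ... | yes v≡s = ⊥-elim (v≢s v≡s)
    ... | no _ = refl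
    agree : ∀ {w} → w ∈ V → E s w → lab w ≡ lab (proj₁ chosen)
    agree {w} w∈V sw with lab w ≟ lab (proj₁ chosen)
    ... | yes p = p
    ... | no w≢ = ⊥-elim (Ambiguous.absurd valid s∈ s-sink w∈V (proj₁ (proj₂ chosen)) sw (proj₁ (proj₂ (proj₂ chosen))) w≢)
    settled′ : ∀ {v w} → v ∈ rest → v ∉ Todo ∖ s → w ∈ V → E v w → w ∉ Todo ∖ s × lab′ w ≡ lab′ v
    settled′ {v} {w} v∈rest v∉ w∈V vw with v ≟ s
    ... | yes refl = (λ w∈ → s-sink w (proj₁ (∈⁻ w∈)) vw) ,
                     trans (lab′-≢ λ { refl → s-sink w s∈ vw }) (agree w∈V vw)
    ... | no v≢s with w∉Todo , eq ← settled v∈rest (λ v∈Todo → v∉ (∈⁺ (v∈Todo , v≢s))) w∈V vw =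
      (λ w∈ → w∉Todo (proj₁ (∈⁻ w∈))) , trans (lab′-≢ λ { refl → w∉Todo s∈ }) eq

  opaque
    labels : Labels
    labels = go rest (⊂-wellFounded rest) (initial , record
      { todo = λ x → x ; lab-C = initial-C ; settled = λ v∈rest v∉rest → ⊥-elim (v∉rest v∈rest) })
      where
      initial : Fin n → Fin k
      initial v with any? (λ i → v ∈? C i)
      ... | yes (i , _) = i
      ... | no _ = i₀
      initial-C : ∀ {i v} → v ∈ C i → initial v ≡ i
      initial-C {i} {v} v∈C with any? (λ i → v ∈? C i)
      ... | yes (j , v∈Cj) = disjoint v∈Cj v∈C
      ... | no ¬p = ⊥-elim (¬p (i , v∈C))
      go : ∀ Todo → Acc _⊂_ Todo → ∃ (Valid Todo) → Labels
      go Todo (acc rs) (lab , valid) with nonempty? Todo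
      ... | no empty = lab , lab-C , λ v∈rest w∈V vw → proj₂ (settled v∈rest (λ v∈ → empty (_ , v∈)) w∈V vw)
        where open Valid valid
      ... | yes (_ , x∈)
            with s , s∈ , s-sink ← sink E? rest-acyclic (Valid.todo valid) (proj₁ ∘ ∈⁻ ∘ Valid.todo valid) x∈
            = go (Todo ∖ s) (rs (∖-⊂ s∈)) (extend valid s∈ s-sink)

-- Parts, their cores, and the vertices with arcs to other parts.

module Structure {n : ℕ} {E : Fin n → Fin n → Set} (E? : ∀ v w → Dec (E v w)) {V : Subset n}
  (smaller : Smaller V) (big : Big E V) (no-single : ∀ u → ¬ Single E V u)
  {k : ℕ} (P : Packing E V (suc (suc k))) (min : ∀ i → Minimal E V (Packing.C P i))
  (no-larger : ¬ Packing E V (suc (suc (suc k)))) where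

  open Counterexample E? smaller big no-single
  open Packing P

  I : Set
  I = Fin (suc (suc k))

  open Labelling E? smaller big no-single zero P no-larger using (labels)

  lab : Fin n → I
  lab = proj₁ labels

  lab-C : ∀ {i v} → v ∈ C i → lab v ≡ i
  lab-C = proj₁ (proj₂ labels)

  C⊆V : ∀ {i v} → v ∈ C i → v ∈ V
  C⊆V {i} = proj₁ (self i)

  lab-stays : ∀ {v w} → v ∈ V → v ∉ C (lab v) → w ∈ V → E v w → lab w ≡ lab v
  lab-stays {v} v∈V v∉C = proj₂ (proj₂ labels)
    (∈⁺ (v∈V , λ { (i , v∈C) → v∉C (subst (λ j → v ∈ C j) (sym (lab-C v∈C)) v∈C) }))

  Part : I → Subset n
  Part i = ⟪ (λ v → (v ∈? V) ×-dec (lab v ≟ i)) ⟫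

  part-next : ∀ {v} → v ∈ V → ∃ λ w → w ∈ V × lab w ≡ lab v × E v w
  part-next {v} v∈V with v ∈? C (lab v)
  ... | yes v∈C = let w , w∈C , vw = proj₂ (self (lab v)) v v∈C in w , C⊆V w∈C , lab-C w∈C , vw
  ... | no v∉C = let w , w∈V , vw , _ = pick v∈V [] in w , w∈V , lab-stays v∈V v∉C w∈V vw , vw

  part-self : ∀ i → Self E V (Part i)
  part-self i = proj₁ ∘ ∈⁻ , λ v v∈ → let v∈V , v≡i = ∈⁻ v∈ ; w , w∈V , w≡v , vw = part-next v∈V
                                      in w , ∈⁺ (w∈V , trans w≡v v≡i) , vw

  sep-parts : ∀ {u w} → u ∈ V → w ∈ V → lab u ≢ lab w → Sep E V u w
  sep-parts {u} {w} u∈V w∈V u≢w = Part (lab u) , Part (lab w) , part-self _ , part-self _ ,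
    (λ v v∈ v∈′ → u≢w (trans (sym (proj₂ (∈⁻ v∈))) (proj₂ (∈⁻ v∈′)))) , ∈⁺ (u∈V , refl) , ∈⁺ (w∈V , refl)

  another : ∀ (i : I) → ∃ λ j → j ≢ i
  another zero = suc zero , λ ()
  another (suc i) = zero , λ ()

  Exit : Fin n → Set
  Exit v = ∃ λ y → y ∈ V × E v y × lab y ≢ lab v

  exit? : ∀ v → Dec (Exit v)
  exit? v = any? λ y → (y ∈? V) ×-dec E? v y ×-dec ¬? (lab y ≟ lab v)

  stays : ∀ {v w} → ¬ Exit v → w ∈ V → E v w → lab w ≡ lab v
  stays {v} {w} ¬exit w∈V vw with lab w ≟ lab v
  ... | yes p = p
  ... | no ¬p = ⊥-elim (¬exit (w , w∈V , vw , ¬p))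

  exit⇒core : ∀ {v} → v ∈ V → Exit v → v ∈ C (lab v)
  exit⇒core {v} v∈V (y , y∈V , vy , y≢v) with v ∈? C (lab v)
  ... | yes p = p
  ... | no v∉C = ⊥-elim (y≢v (lab-stays v∈V v∉C y∈V vy))

  some-exit : ∀ i → ∃ λ l → l ∈ V × lab l ≡ i × Exit l
  some-exit i with any? (λ l → (l ∈? V) ×-dec (lab l ≟ i) ×-dec exit? l)
  ... | yes p = p
  ... | no ¬p with j , j≢i ← another i with x , x∈C ← inhab j with c , c∈C ← inhab i =
    ⊥-elim (no-closed-subset (Part i)
      (proj₁ ∘ ∈⁻ , x , C⊆V x∈C , λ x∈ → j≢i (trans (sym (lab-C x∈C)) (proj₂ (∈⁻ x∈))))
      (c , ∈⁺ (C⊆V c∈C , lab-C c∈C))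
      λ v w v∈ w∈V vw → let v∈V , v≡i = ∈⁻ v∈ in
        ∈⁺ (w∈V , trans (stays (λ e → ¬p (v , v∈V , v≡i , e)) w∈V vw) v≡i))

  -- Otherwise X could replace the core of its part; the labels would not change,
  -- but l would no longer be in the core.
  opaque
    exit-in : ∀ {X l} → Self E V X → X ⊆ Part (lab l) → Nonempty X → l ∈ V → Exit l → l ∈ X
    exit-in {X} {l} X-self X⊆ X≠∅ l∈V (y , y∈V , ly , y≢l) with l ∈? X
    ... | yes l∈X = l∈X
    ... | no l∉X = ⊥-elim (y≢l (trans (sym (same y∈V)) (trans (proj₂ (proj₂ L′.labels) l∈rest y∈V ly) (same l∈V))))
      where
      i : I
      i = lab l
      C′ : I → Subset n
      C′ j with j ≟ i
      ... | yes _ = X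
      ... | no _ = C j
      C′⁻ : ∀ j {v} → v ∈ C′ j → (j ≡ i × v ∈ X) ⊎ (j ≢ i × v ∈ C j)
      C′⁻ j v∈ with j ≟ i
      ... | yes eq = inj₁ (eq , v∈)
      ... | no neq = inj₂ (neq , v∈)
      lab-C′ : ∀ j {v} → v ∈ C′ j → lab v ≡ j
      lab-C′ j v∈ with C′⁻ j v∈
      ... | inj₁ (j≡i , v∈X) = trans (proj₂ (∈⁻ (X⊆ v∈X))) (sym j≡i)
      ... | inj₂ (_ , v∈C) = lab-C v∈C
      self′ : ∀ j → Self E V (C′ j)
      self′ j with j ≟ i
      ... | yes _ = X-self
      ... | no _ = self j
      inhab′ : ∀ j → Nonempty (C′ j)
      inhab′ j with j ≟ i
      ... | yes _ = X≠∅
      ... | no _ = inhab j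
      P′ : Packing E V (suc (suc k))
      P′ = record { C = C′ ; self = self′ ; inhab = inhab′
                  ; disjoint = λ {i} {j} p q → trans (sym (lab-C′ i p)) (lab-C′ j q) }
      module L′ = Labelling E? smaller big no-single zero P′ no-larger
      lab′ : Fin n → I
      lab′ = proj₁ L′.labels
      -- A changed vertex lies off the new cores, so its out-neighbour in the same old part also
      -- shares its new label and is changed too. Acyclicity of the new rest leaves no such vertex.
      Changed : Subset n
      Changed = ⟪ (λ v → (v ∈? V) ×-dec ¬? (lab′ v ≟ lab v)) ⟫
      changed⊆rest : Changed ⊆ L′.rest
      changed⊆rest v∈ = let v∈V , v≢ = ∈⁻ v∈ in
        ∈⁺ (v∈V , λ { (j , v∈C′) → v≢ (trans (proj₁ (proj₂ L′.labels) v∈C′) (sym (lab-C′ j v∈C′))) })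
      changed-self : Self E V Changed
      changed-self = proj₁ ∘ ∈⁻ , λ v v∈ →
        let v∈V , v≢ = ∈⁻ v∈
            w , w∈V , w≡v , vw = part-next v∈V
            w≡′v = proj₂ (proj₂ L′.labels) (changed⊆rest v∈) w∈V vw
        in w , ∈⁺ (w∈V , λ eq → v≢ (trans (sym w≡′v) (trans eq w≡v))) , vw
      same : ∀ {v} → v ∈ V → lab′ v ≡ lab v
      same {v} v∈V with lab′ v ≟ lab v
      ... | yes p = p
      ... | no ¬p = ⊥-elim (L′.rest-acyclic Changed changed⊆rest changed-self v (∈⁺ (v∈V , ¬p)))
      l∈rest : l ∈ L′.rest
      l∈rest = ∈⁺ (l∈V , λ { (j , l∈C′) → case C′⁻ j l∈C′ of λ where
        (inj₁ (_ , l∈X)) → l∉X l∈X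
        (inj₂ (j≢i , l∈C)) → j≢i (sym (lab-C l∈C)) })

  -- Exits propagate along arcs inside a part.

  module ExitStep {l} (l∈V : l ∈ V) (l-exit : Exit l) where

    A : Subset n
    A = Part (lab l) ∖ l

    A⁺ : ∀ {v} → v ∈ V → lab v ≡ lab l → v ≢ l → v ∈ A
    A⁺ v∈V v≡ v≢l = ∈⁺ (∈⁺ (v∈V , v≡) , v≢l)

    A⇒V : ∀ {v} → v ∈ A → v ∈ V
    A⇒V v∈A = proj₁ (∈⁻ (proj₁ (∈⁻ v∈A)))

    A⇒lab : ∀ {v} → v ∈ A → lab v ≡ lab l
    A⇒lab v∈A = proj₂ (∈⁻ (proj₁ (∈⁻ v∈A)))

    A⇒≢ : ∀ {v} → v ∈ A → v ≢ l
    A⇒≢ v∈A = proj₂ (∈⁻ v∈A)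

    A-acyclic : Acyclic E V A
    A-acyclic X X⊆A X-self v v∈X =
      A⇒≢ (X⊆A (exit-in X-self (proj₁ ∘ ∈⁻ ∘ X⊆A) (v , v∈X) l∈V l-exit)) refl

    opaque
      ranked : ∃ λ (ρ : Fin n → ℕ) → ∀ v w → v ∈ A → w ∈ A → E v w → ρ w < ρ v
      ranked = rank E? A-acyclic A⇒V

    ρ : Fin n → ℕ
    ρ = proj₁ ranked

    -- Stands for the vertex set of a path from `l` to `x`, with `l` left out and the order
    -- forgotten. `x-low` guarantees that no out-neighbour of `x` in `A` is already on it.
    record Chain (x : Fin n) : Set where
      field
        U       : Subset n
        U⊆A     : U ⊆ A
        x∈U     : x ∈ U
        x-low   : ∀ v → v ∈ U → ρ x ≤ ρ v
        advance : ∀ v → v ∈ U → v ≡ x ⊎ (∃ λ w → w ∈ U × E v w)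
        start   : ∃ λ v → v ∈ U × E l v

    singleton : ∀ {x} → x ∈ A → E l x → Chain x
    singleton {x} x∈A lx = record
      { U = ⟪ _≟ x ⟫ ; U⊆A = λ v∈ → subst (_∈ A) (sym (∈⁻ v∈)) x∈A ; x∈U = ∈⁺ refl
      ; x-low = λ v v∈ → subst (λ z → ρ x ≤ ρ z) (sym (∈⁻ v∈)) ≤-refl
      ; advance = λ v v∈ → inj₁ (∈⁻ v∈) ; start = x , ∈⁺ refl , lx }

    lengthen : ∀ {x x′} → Chain x → x′ ∈ A → E x x′ → Chain x′
    lengthen {x} {x′} ch x′∈A xx′ = record
      { U = add x′ U ; U⊆A = within ; x∈U = ∈⁺ (inj₂ refl) ; x-low = low ; advance = advance′
      ; start = let v , v∈U , lv = start in v , ∈⁺ (inj₁ v∈U) , lv }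
      where
      open Chain ch
      within : add x′ U ⊆ A
      within v∈ with ∈⁻ v∈
      ... | inj₁ v∈U = U⊆A v∈U
      ... | inj₂ refl = x′∈A
      low : ∀ v → v ∈ add x′ U → ρ x′ ≤ ρ v
      low v v∈ with ∈⁻ v∈
      ... | inj₁ v∈U = ≤-trans (<⇒≤ (proj₂ ranked x x′ (U⊆A x∈U) x′∈A xx′)) (x-low v v∈U)
      ... | inj₂ refl = ≤-refl
      advance′ : ∀ v → v ∈ add x′ U → v ≡ x′ ⊎ (∃ λ w → w ∈ add x′ U × E v w)
      advance′ v v∈ with ∈⁻ v∈
      ... | inj₂ eq = inj₁ eq
      ... | inj₁ v∈U with advance v v∈U
      ...   | inj₁ refl = inj₂ (x′ , ∈⁺ (inj₂ refl) , xx′)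
      ...   | inj₂ (w , w∈U , vw) = inj₂ (w , ∈⁺ (inj₁ w∈U) , vw)

    -- The chain from l down to x, continued at l₂ and below, closes up through l without meeting l₁.
    skip : ∀ {x l₁ l₂} → Chain x → l₁ ∈ A → l₂ ∈ A → E x l₁ → E x l₂ → l₁ ≢ l₂ → ρ l₂ ≤ ρ l₁ → ¬ Exit l₁
    skip {x} {l₁} {l₂} ch l₁∈A l₂∈A xl₁ xl₂ l₁≢l₂ l₂≤l₁ l₁-exit =
      l₁∉Z (∈⁻ (exit-in Z-self Z⊆ (l , ∈⁺ (inj₁ refl)) (A⇒V l₁∈A) l₁-exit))
      where
      open Chain ch
      Z : Subset n
      Z = ⟪ (λ v → (v ≟ l) ⊎-dec (v ∈? U) ⊎-dec ((v ∈? A) ×-dec ((v ≟ l₂) ⊎-dec (ρ v <? ρ l₂)))) ⟫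
      below : ∀ {v} → v ∈ A → ρ v ≤ ρ l₂ → ∃ λ w → w ∈ Z × E v w
      below {v} v∈A v≤l₂ with w , w∈V , w≡v , vw ← part-next (A⇒V v∈A) with w ≟ l
      ... | yes refl = l , ∈⁺ (inj₁ refl) , vw
      ... | no w≢l = let w∈A = A⁺ w∈V (trans w≡v (A⇒lab v∈A)) w≢l in
        w , ∈⁺ (inj₂ (inj₂ (w∈A , inj₂ (<-≤-trans (proj₂ ranked v w v∈A w∈A vw) v≤l₂)))) , vw
      next : ∀ {v} → v ≡ l ⊎ v ∈ U ⊎ (v ∈ A × (v ≡ l₂ ⊎ ρ v < ρ l₂)) → ∃ λ w → w ∈ Z × E v w
      next (inj₁ refl) = let w , w∈U , lw = start in w , ∈⁺ (inj₂ (inj₁ w∈U)) , lw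
      next (inj₂ (inj₂ (v∈A , inj₁ refl))) = below v∈A ≤-refl
      next (inj₂ (inj₂ (v∈A , inj₂ v<))) = below v∈A (<⇒≤ v<)
      next (inj₂ (inj₁ v∈U)) with advance _ v∈U
      ... | inj₁ refl = l₂ , ∈⁺ (inj₂ (inj₂ (l₂∈A , inj₁ refl))) , xl₂
      ... | inj₂ (w , w∈U , vw) = w , ∈⁺ (inj₂ (inj₁ w∈U)) , vw
      place : ∀ {v} → v ≡ l ⊎ v ∈ U ⊎ (v ∈ A × (v ≡ l₂ ⊎ ρ v < ρ l₂)) → v ∈ V × lab v ≡ lab l
      place (inj₁ refl) = l∈V , refl
      place (inj₂ (inj₁ v∈U)) = A⇒V (U⊆A v∈U) , A⇒lab (U⊆A v∈U)
      place (inj₂ (inj₂ (v∈A , _))) = A⇒V v∈A , A⇒lab v∈A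
      Z-self : Self E V Z
      Z-self = (λ v∈ → proj₁ (place (∈⁻ v∈))) , λ v v∈ → next (∈⁻ v∈)
      Z⊆ : Z ⊆ Part (lab l₁)
      Z⊆ v∈ = let v∈V , eq = place (∈⁻ v∈) in ∈⁺ (v∈V , trans eq (sym (A⇒lab l₁∈A)))
      l₁∉Z : ¬ (l₁ ≡ l ⊎ l₁ ∈ U ⊎ (l₁ ∈ A × (l₁ ≡ l₂ ⊎ ρ l₁ < ρ l₂)))
      l₁∉Z (inj₁ eq) = A⇒≢ l₁∈A eq
      l₁∉Z (inj₂ (inj₁ l₁∈U)) =
        n≮n _ (<-≤-trans (proj₂ ranked x l₁ (U⊆A x∈U) l₁∈A xl₁) (x-low l₁ l₁∈U))
      l₁∉Z (inj₂ (inj₂ (_ , inj₁ eq))) = l₁≢l₂ eq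
      l₁∉Z (inj₂ (inj₂ (_ , inj₂ lt))) = n≮n _ (<-≤-trans lt l₂≤l₁)

    -- While `x` has an out-neighbour that is no exit, move there; the rank drops below `m` each
    -- time. Otherwise two out-neighbours of `x` other than `l` are exits, and `skip` refutes one
    -- whose rank is at least that of the other.
    descend : ∀ m {x} → ρ x < m → Chain x → ¬ Exit x → ⊥
    descend (suc m) {x} x<m ch ¬exit with any? (λ x′ → (x′ ∈? V) ×-dec E? x x′ ×-dec ¬? (exit? x′))
    ... | yes (x′ , x′∈V , xx′ , ¬exit′) =
      descend m (<-≤-trans (proj₂ ranked x x′ (U⊆A x∈U) x′∈A xx′) (≤-pred x<m)) (lengthen ch x′∈A xx′) ¬exit′
      where
      open Chain ch
      x′∈A : x′ ∈ A
      x′∈A = A⁺ x′∈V (trans (stays ¬exit x′∈V xx′) (A⇒lab (U⊆A x∈U))) λ { refl → ¬exit′ l-exit }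
    ... | no ¬p
        with l₁ , l₁∈V , xl₁ , l₁≢l ∷ [] ← pick (A⇒V (Chain.U⊆A ch (Chain.x∈U ch))) (l ∷ [])
        with l₂ , l₂∈V , xl₂ , l₂≢l ∷ l₂≢l₁ ∷ [] ← pick (A⇒V (Chain.U⊆A ch (Chain.x∈U ch))) (l ∷ l₁ ∷ [])
        = finish (≤-total (ρ l₁) (ρ l₂))
      where
      open Chain ch
      inA : ∀ {v} → v ∈ V → E x v → v ≢ l → v ∈ A
      inA v∈V xv = A⁺ v∈V (trans (stays ¬exit v∈V xv) (A⇒lab (U⊆A x∈U)))
      exits : ∀ {v} → v ∈ V → E x v → Exit v
      exits {v} v∈V xv with exit? v
      ... | yes e = e
      ... | no ¬e = ⊥-elim (¬p (v , v∈V , xv , ¬e))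
      finish : ρ l₁ ≤ ρ l₂ ⊎ ρ l₂ ≤ ρ l₁ → ⊥
      finish (inj₁ l₁≤l₂) = skip ch (inA l₂∈V xl₂ l₂≢l) (inA l₁∈V xl₁ l₁≢l) xl₂ xl₁ l₂≢l₁ l₁≤l₂ (exits l₂∈V xl₂)
      finish (inj₂ l₂≤l₁) = skip ch (inA l₁∈V xl₁ l₁≢l) (inA l₂∈V xl₂ l₂≢l) xl₁ xl₂ (l₂≢l₁ ∘ sym) l₂≤l₁ (exits l₁∈V xl₁)

    exit-step : ∀ {x} → x ∈ V → lab x ≡ lab l → E l x → Exit x
    exit-step {x} x∈V x≡l lx with exit? x
    ... | yes e = e
    ... | no ¬e = ⊥-elim (descend _ ≤-refl (singleton (A⁺ x∈V x≡l λ { refl → ¬e l-exit }) lx) ¬e)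

  -- Arcs leaving a core and the permutation of the parts.

  open ExitStep using (exit-step)

  opaque
    -- By `exit-step` the exits of a part form a self-sustaining subset of its core, nonempty by
    -- `some-exit`; minimality makes it the whole core.
    core⇒exit : ∀ {i c} → c ∈ C i → Exit c
    core⇒exit {i} {c} c∈C with l , l∈V , l≡i , l-exit ← some-exit i =
      proj₂ (proj₂ (∈⁻ (proj₂ (proj₂ (min i)) Exits Exits⊆C Exits-self (l , ∈⁺ (l∈V , l≡i , l-exit)) c∈C)))
      where
      Exits : Subset n
      Exits = ⟪ (λ v → (v ∈? V) ×-dec (lab v ≟ i) ×-dec exit? v) ⟫
      Exits⊆C : Exits ⊆ C i
      Exits⊆C {v} v∈ = let v∈V , v≡i , e = ∈⁻ v∈ in subst (λ j → v ∈ C j) v≡i (exit⇒core v∈V e)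
      Exits-self : Self E V Exits
      Exits-self = proj₁ ∘ ∈⁻ , λ v v∈ →
        let v∈V , v≡i , e = ∈⁻ v∈ ; w , w∈V , w≡v , vw = part-next v∈V
        in w , ∈⁺ (w∈V , trans w≡v v≡i , exit-step v∈V e w∈V w≡v vw) , vw

  module Cyc i = Cycle (cycle E? (min i))
  open Cyc public

  part-next-unique : ∀ {i c w} → c ∈ C i → w ∈ V → lab w ≡ i → E c w → w ≡ next i c
  part-next-unique {i} {c} {w} c∈C w∈V w≡i cw = chordless i c∈C (subst (λ j → w ∈ C j) w≡i
    (exit⇒core w∈V (exit-step (C⊆V c∈C) (core⇒exit c∈C) w∈V (trans w≡i (sym (lab-C c∈C))) cw))) cw

  Without : I → Fin n → Subset n → Subset n
  Without i c B = ⟪ (λ v → ((v ∈? V) ×-dec (lab v ≟ i) ×-dec ¬? (v ≟ c)) ⊎-dec (v ∈? B)) ⟫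

  -- Once c has left its part, only the predecessor of c needs a new out-neighbour.
  without-self : ∀ {i c B t} → c ∈ C i → B ⊆ V → (∀ v → v ∈ B → ∃ λ w → w ∈ Without i c B × E v w) →
    t ∈ B → E (prev i c) t → Self E V (Without i c B)
  without-self {i} {c} {B} {t} c∈C B⊆V B-next t∈B pt = within , λ v v∈ → next′ v (∈⁻ v∈)
    where
    within : Without i c B ⊆ V
    within v∈ with ∈⁻ v∈
    ... | inj₁ (v∈V , _) = v∈V
    ... | inj₂ v∈B = B⊆V v∈B
    next′ : ∀ v → (v ∈ V × lab v ≡ i × v ≢ c) ⊎ v ∈ B → ∃ λ w → w ∈ Without i c B × E v w
    next′ v (inj₂ v∈B) = B-next v v∈B
    next′ v (inj₁ (v∈V , v≡i , v≢c)) with v ∈? C (lab v)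
    ... | no v∉C with w , w∈V , vw , w≢c ∷ [] ← pick v∈V (c ∷ []) =
      w , ∈⁺ (inj₁ (w∈V , trans (lab-stays v∈V v∉C w∈V vw) v≡i , w≢c)) , vw
    next′ v (inj₁ (v∈V , refl , v≢c)) | yes v∈C with next i v ≟ c
    ... | yes eq = t , ∈⁺ (inj₂ t∈B) , subst (λ x → E x t) (trans (cong (prev i) (sym eq)) (prev-next i v)) pt
    ... | no neq = next i v , ∈⁺ (inj₁ (C⊆V (next-∈ i v∈C) , lab-C (next-∈ i v∈C) , neq)) , next-arc i v∈C

  core-single : ∀ {i c} → c ∈ C i → (∀ w → w ∈ V → lab w ≡ i → w ≢ c → Sep E V c w) → ⊥
  core-single {i} {c} c∈C sep = no-single c (C⊆V c∈C , λ w w∈V w≢c → case lab w ≟ i of λ where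
    (yes w≡i) → sep w w∈V w≡i w≢c
    (no w≢i) → sep-parts (C⊆V c∈C) w∈V λ eq → w≢i (trans (sym eq) (lab-C c∈C)))

  -- With different labels, `c` could join the part of `y` while the rest of its own part falls back
  -- on the part of `z` through `prev i c`. That would make `c` a singleton class.
  same-target : ∀ {i c y z} → c ∈ C i → y ∈ V → E c y → lab y ≢ i → z ∈ V → E (prev i c) z → lab z ≢ i → lab y ≡ lab z
  same-target {i} {c} {y} {z} c∈C y∈V cy y≢i z∈V pz z≢i with lab y ≟ lab z
  ... | yes p = p
  ... | no y≢z = ⊥-elim (core-single c∈C λ w w∈V w≡i w≢c →
      add c (Part (lab y)) , Without i c (Part (lab z)) ,
      self-add E? (part-self _) (C⊆V c∈C) (∈⁺ {x = y} (y∈V , refl)) cy ,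
      without-self c∈C (proj₁ ∘ ∈⁻) (λ v v∈ → let w , w∈ , vw = proj₂ (part-self _) v v∈ in w , ∈⁺ (inj₂ w∈) , vw)
        (∈⁺ (z∈V , refl)) pz ,
      (λ v v∈ v∈′ → apart (∈⁻ v∈) (∈⁻ v∈′)) , ∈⁺ (inj₂ refl) , ∈⁺ (inj₁ (w∈V , w≡i , w≢c)))
    where
    apart : ∀ {v} → v ∈ Part (lab y) ⊎ v ≡ c → ¬ ((v ∈ V × lab v ≡ i × v ≢ c) ⊎ v ∈ Part (lab z))
    apart (inj₁ p) (inj₁ (_ , v≡i , _)) = y≢i (trans (sym (proj₂ (∈⁻ p))) v≡i)
    apart (inj₁ p) (inj₂ q) = y≢z (trans (sym (proj₂ (∈⁻ p))) (proj₂ (∈⁻ q)))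
    apart (inj₂ refl) (inj₁ (_ , _ , v≢c)) = v≢c refl
    apart (inj₂ refl) (inj₂ q) = z≢i (trans (sym (proj₂ (∈⁻ q))) (lab-C c∈C))

  exit-of : ∀ {i c} → c ∈ C i → ∃ λ y → y ∈ V × E c y × lab y ≢ i
  exit-of c∈C = let y , y∈V , cy , y≢ = core⇒exit c∈C in y , y∈V , cy , λ eq → y≢ (trans eq (sym (lab-C c∈C)))

  opaque
    -- Read off from one arbitrary core vertex; in `hits-J`, `same-target` carries this part
    -- backwards around the cycle.
    J : I → I
    J i = lab (proj₁ (exit-of (proj₂ (inhab i))))

    J≢ : ∀ i → J i ≢ i
    J≢ i = proj₂ (proj₂ (proj₂ (exit-of (proj₂ (inhab i)))))

    hits-J : ∀ {i c} → c ∈ C i → ∃ λ y → y ∈ V × E c y × lab y ≡ J i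
    hits-J {i} = prev-closed i {λ c → ∃ λ y → y ∈ V × E c y × lab y ≡ J i}
      (λ c → any? λ y → (y ∈? V) ×-dec E? c y ×-dec (lab y ≟ J i)) step (proj₂ (inhab i))
      (let y , y∈V , cy , _ = exit-of (proj₂ (inhab i)) in y , y∈V , cy , refl)
      where
      step : ∀ c → c ∈ C i → (∃ λ y → y ∈ V × E c y × lab y ≡ J i) → ∃ λ y → y ∈ V × E (prev i c) y × lab y ≡ J i
      step c c∈C (y , y∈V , cy , y≡J) = let z , z∈V , pz , z≢i = exit-of (prev-∈ i c∈C) in
        z , z∈V , pz , trans (sym (same-target c∈C y∈V cy (λ y≡i → J≢ i (trans (sym y≡J) y≡i)) z∈V pz z≢i)) y≡J

  core-next : ∀ {i c y} → c ∈ C i → y ∈ V → E c y → y ≡ next i c ⊎ lab y ≡ J i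
  core-next {i} {c} {y} c∈C y∈V cy with lab y ≟ i
  ... | yes y≡i = inj₁ (part-next-unique c∈C y∈V y≡i cy)
  ... | no y≢i = let z , z∈V , pz , z≡J = hits-J (prev-∈ i c∈C) in
    inj₂ (trans (same-target c∈C y∈V cy y≢i z∈V pz (λ z≡i → J≢ i (trans (sym z≡J) z≡i))) z≡J)

  lab-next : ∀ {v w} → v ∈ V → w ∈ V → E v w → lab w ≡ lab v ⊎ (v ∈ C (lab v) × lab w ≡ J (lab v))
  lab-next {v} {w} v∈V w∈V vw with v ∈? C (lab v)
  ... | no v∉C = inj₁ (lab-stays v∈V v∉C w∈V vw)
  ... | yes v∈C with core-next v∈C w∈V vw
  ...   | inj₁ refl = inj₁ (lab-C (next-∈ (lab v) v∈C))
  ...   | inj₂ w≡J = inj₂ (v∈C , w≡J)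

  opaque
    -- Arcs leave part `i` only towards part `J i`, so the union of the parts in the image of `J` is
    -- closed under out-neighbours and cannot be a proper subset of `V`.
    J-onto : ∀ j → ∃ λ i → J i ≡ j
    J-onto j with any? (λ i → J i ≟ j)
    ... | yes p = p
    ... | no ¬p = ⊥-elim (no-closed-subset Im
        (proj₁ ∘ ∈⁻ , proj₁ (inhab j) , C⊆V (proj₂ (inhab j)) ,
          λ x∈ → let i , eq = proj₂ (∈⁻ x∈) in ¬p (i , trans eq (lab-C (proj₂ (inhab j)))))
        (let c , c∈C = inhab (J j) in c , ∈⁺ (C⊆V c∈C , j , sym (lab-C c∈C)))
        λ v w v∈ w∈V vw → let v∈V , i , eq = ∈⁻ v∈ in ∈⁺ (w∈V , image eq (lab-next v∈V w∈V vw)))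
      where
      Im : Subset n
      Im = ⟪ (λ v → (v ∈? V) ×-dec any? λ i → J i ≟ lab v) ⟫
      image : ∀ {v w i} → J i ≡ lab v → lab w ≡ lab v ⊎ (v ∈ C (lab v) × lab w ≡ J (lab v)) → ∃ λ i → J i ≡ lab w
      image eq (inj₁ w≡v) = _ , trans eq (sym w≡v)
      image {v} eq (inj₂ (_ , w≡J)) = lab v , sym w≡J

  J⁻¹ : I → I
  J⁻¹ j = proj₁ (J-onto j)

  J-J⁻¹ : ∀ j → J (J⁻¹ j) ≡ j
  J-J⁻¹ j = proj₂ (J-onto j)

  J⁻¹-J : ∀ i → J⁻¹ (J i) ≡ i
  J⁻¹-J = right-inverse⇒left-inverse J J⁻¹ J-J⁻¹

-- Vertices that receive arcs from a whole core.

module Colouring {n : ℕ} {E : Fin n → Fin n → Set} (E? : ∀ v w → Dec (E v w)) {V : Subset n}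
  (smaller : Smaller V) (big : Big E V) (no-single : ∀ u → ¬ Single E V u)
  {k : ℕ} (P : Packing E V (suc (suc k))) (min : ∀ i → Minimal E V (Packing.C P i))
  (no-larger : ¬ Packing E V (suc (suc (suc k)))) where

  open Counterexample E? smaller big no-single
  open Packing P
  open Structure E? smaller big no-single P min no-larger

  -- The common in-neighbour of `c` and `y` lies in the part of `c`, and is then `prev a c`, or in
  -- the part of `y`, and is then a core vertex with successor `y`, since it has an arc to another
  -- part.
  dichotomy : ∀ {a c y} → c ∈ C a → y ∈ V → lab y ≡ J a → E c y →
    E (prev a c) y ⊎ (∃ λ z → z ∈ C (J a) × next (J a) z ≡ y × E z c)
  dichotomy {a} {c} {y} c∈C y∈V y≡J cy = go (dominated (C⊆V c∈C) y∈V (λ { refl → y≢c refl })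
      (sep-parts y∈V (C⊆V c∈C) y≢c) cy)
    where
    y≢c : lab y ≢ lab c
    y≢c eq = J≢ a (trans (sym y≡J) (trans eq (lab-C c∈C)))
    go : (∃ λ z → z ∈ V × E z c × E z y) → E (prev a c) y ⊎ (∃ λ z → z ∈ C (J a) × next (J a) z ≡ y × E z c)
    go (z , z∈V , zc , zy) with lab-next z∈V (C⊆V c∈C) zc | lab-next z∈V y∈V zy
    ... | inj₁ c≡z | inj₁ y≡z = ⊥-elim (y≢c (trans y≡z (sym c≡z)))
    ... | inj₂ (_ , c≡J) | inj₂ (_ , y≡J′) = ⊥-elim (y≢c (trans y≡J′ (sym c≡J)))
    ... | inj₁ c≡z | inj₂ (z∈C , _) = inj₁ (subst (λ x → E x y) (sym prev≡z) zy)
      where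
      z∈Ca : z ∈ C a
      z∈Ca = subst (λ j → z ∈ C j) (trans (sym c≡z) (lab-C c∈C)) z∈C
      prev≡z : prev a c ≡ z
      prev≡z = trans (cong (prev a) (part-next-unique z∈Ca (C⊆V c∈C) (lab-C c∈C) zc)) (prev-next a z)
    ... | inj₂ (z∈C , _) | inj₁ y≡z = inj₂ (z , z∈CJ , sym (part-next-unique z∈CJ y∈V y≡J zy) , zc)
      where
      z∈CJ : z ∈ C (J a)
      z∈CJ = subst (λ j → z ∈ C j) (trans (sym y≡z) y≡J) z∈C

  -- Forbidding `next a c` takes one of the 14 places; all other out-neighbours of `c` lie in part
  -- `J a`.
  J-neighbour : ∀ {a c} → c ∈ C a → ∀ xs → length xs ≤ 13 → ∃ λ y → y ∈ V × lab y ≡ J a × E c y × All (y ≢_) xs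
  J-neighbour {a} {c} c∈C xs len with y , y∈V , cy , y≢next ∷ new ← big c (C⊆V c∈C) (next a c ∷ xs) (s≤s len)
    with core-next c∈C y∈V cy
  ... | inj₁ y≡next = ⊥-elim (y≢next y≡next)
  ... | inj₂ y≡J = y , y∈V , y≡J , cy , new

  Common : I → Fin n → Set
  Common a y = y ∈ V × lab y ≡ J a × (∀ {c} → c ∈ C a → E c y)

  common : ∀ {a c y} → c ∈ C a → y ∈ V → lab y ≡ J a → E c y →
    (∀ {c z} → c ∈ C a → z ∈ C (J a) → next (J a) z ≡ y → ¬ E z c) → Common a y
  common {a} {c} {y} c∈C y∈V y≡J cy none = y∈V , y≡J , prev-closed a (λ x → E? x y) step c∈C cy
    where
    step : ∀ x → x ∈ C a → E x y → E (prev a x) y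
    step x x∈C xy with dichotomy x∈C y∈V y≡J xy
    ... | inj₁ p = p
    ... | inj₂ (z , z∈C , eq , zx) = ⊥-elim (none x∈C z∈C eq zx)

  common-off-core : ∀ {a c y} → c ∈ C a → y ∈ V → lab y ≡ J a → E c y → y ∉ C (J a) → Common a y
  common-off-core {a} c∈C y∈V y≡J cy y∉C =
    common c∈C y∈V y≡J cy λ _ z∈C eq _ → y∉C (subst (_∈ C (J a)) eq (next-∈ (J a) z∈C))

  -- The arc `e → c` leads back from the next core, which forces `J b` to be `a`. Cut at `e`, the
  -- cycle `C b` becomes a path, along which `δ` measures the distance to `e`.
  module Returning {a c e} (c∈C : c ∈ C a) (e∈C : e ∈ C (J a)) (ec : E e c) where

    b : I
    b = J a

    nx : Fin n → Fin n
    nx = next b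

    C≢ : ∀ {v} → v ∈ C b → lab v ≢ a
    C≢ v∈C eq = J≢ a (trans (sym (lab-C v∈C)) eq)

    J-b : J b ≡ a
    J-b with core-next e∈C (C⊆V c∈C) ec
    ... | inj₁ eq = ⊥-elim (C≢ (subst (_∈ C b) (sym eq) (next-∈ b e∈C)) (lab-C c∈C))
    ... | inj₂ c≡J = trans (sym c≡J) (lab-C c∈C)

    -- Otherwise c together with S is self-sustaining, and so is the rest of its part
    -- together with the rest of the next core, which makes c a singleton class.
    block : ∀ S → S ⊆ C b → (∀ v → v ∈ S → nx v ∈ S ⊎ E v c) →
      ∀ {p t} → p ∈ S → E c p → t ∈ C b → E (prev a c) t → t ∈ S
    block S S⊆C closed {p} {t} p∈S cp t∈C pt with t ∈? S
    ... | yes t∈S = t∈S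
    ... | no t∉S = ⊥-elim (core-single c∈C λ w w∈V w≡a w≢c →
        X , Without a c B , X-self ,
        without-self c∈C (C⊆V ∘ proj₁ ∘ ∈⁻) (λ v v∈ → B-next (proj₁ (∈⁻ v∈))) (∈⁺ (t∈C , t∉S)) pt ,
        (λ v v∈ v∈′ → apart (∈⁻ v∈) (∈⁻ v∈′)) , ∈⁺ (inj₁ refl) , ∈⁺ (inj₁ (w∈V , w≡a , w≢c)))
      where
      X B : Subset n
      X = ⟪ (λ v → (v ≟ c) ⊎-dec (v ∈? S)) ⟫
      B = ⟪ (λ v → (v ∈? C b) ×-dec ¬? (v ∈? S)) ⟫
      X-next : ∀ {v} → v ≡ c ⊎ v ∈ S → ∃ λ w → w ∈ X × E v w
      X-next (inj₁ refl) = p , ∈⁺ (inj₂ p∈S) , cp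
      X-next {v} (inj₂ v∈S) with closed v v∈S
      ... | inj₁ nx∈S = nx v , ∈⁺ (inj₂ nx∈S) , next-arc b (S⊆C v∈S)
      ... | inj₂ vc = c , ∈⁺ (inj₁ refl) , vc
      X⊆V : ∀ {v} → v ≡ c ⊎ v ∈ S → v ∈ V
      X⊆V (inj₁ refl) = C⊆V c∈C
      X⊆V (inj₂ v∈S) = C⊆V (S⊆C v∈S)
      X-self : Self E V X
      X-self = (λ v∈ → X⊆V (∈⁻ v∈)) , λ v v∈ → X-next (∈⁻ v∈)
      B-next : ∀ {v} → v ∈ C b → ∃ λ w → w ∈ Without a c B × E v w
      B-next v∈C with w , w∈V , w≡J , vw , w≢c ∷ [] ← J-neighbour v∈C (c ∷ []) (s≤s z≤n) =
        w , ∈⁺ (inj₁ (w∈V , trans w≡J J-b , w≢c)) , vw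
      apart : ∀ {v} → v ≡ c ⊎ v ∈ S → ¬ ((v ∈ V × lab v ≡ a × v ≢ c) ⊎ v ∈ B)
      apart (inj₁ v≡c) (inj₁ (_ , _ , v≢c)) = v≢c v≡c
      apart (inj₁ refl) (inj₂ v∈B) = C≢ (proj₁ (∈⁻ v∈B)) (lab-C c∈C)
      apart (inj₂ v∈S) (inj₁ (_ , v≡a , _)) = C≢ (S⊆C v∈S) v≡a
      apart (inj₂ v∈S) (inj₂ v∈B) = proj₂ (∈⁻ v∈B) v∈S

    path-acyclic : Acyclic E V (C b ∖ e)
    path-acyclic X X⊆ X-self v v∈X =
      proj₂ (∈⁻ (X⊆ (proj₂ (proj₂ (min b)) X (proj₁ ∘ ∈⁻ ∘ X⊆) X-self (v , v∈X) e∈C))) refl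

    Distance : (Fin n → ℕ) → Set
    Distance δ = ∀ v → v ∈ C b → (v ≡ e × δ v ≡ 0) ⊎ (v ≢ e × δ v ≡ suc (δ (nx v)))

    opaque
      distance : ∃ Distance
      distance = δ , δ-step
        where
        ranked : ∃ λ (ρ : Fin n → ℕ) → ∀ v w → v ∈ C b ∖ e → w ∈ C b ∖ e → E v w → ρ w < ρ v
        ranked = rank E? path-acyclic (C⊆V ∘ proj₁ ∘ ∈⁻)
        ρ : Fin n → ℕ
        ρ = proj₁ ranked
        -- Counts steps towards `e` with bounded fuel. Ranks drop along the way, so by `stable` any
        -- fuel above the rank gives the same answer.
        count : ℕ → Fin n → ℕ
        count zero v = 0
        count (suc m) v = if does (v ≟ e) then 0 else suc (count m (nx v))
        count-e : ∀ m → count m e ≡ 0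
        count-e zero = refl
        count-e (suc m) with e ≟ e
        ... | yes _ = refl
        ... | no ¬p = ⊥-elim (¬p refl)
        descent : ∀ {v} → v ∈ C b → v ≢ e → nx v ≡ e ⊎ ρ (nx v) < ρ v
        descent {v} v∈C v≢e with nx v ≟ e
        ... | yes eq = inj₁ eq
        ... | no neq = inj₂ (proj₂ ranked v (nx v) (∈⁺ (v∈C , v≢e)) (∈⁺ (next-∈ b v∈C , neq)) (next-arc b v∈C))
        stable : ∀ m m′ {v} → v ∈ C b → v ≡ e ⊎ ρ v < m → v ≡ e ⊎ ρ v < m′ → count m v ≡ count m′ v
        stable m m′ v∈C (inj₁ refl) _ = trans (count-e m) (sym (count-e m′))
        stable m m′ v∈C _ (inj₁ refl) = trans (count-e m) (sym (count-e m′))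
        stable (suc m) (suc m′) {v} v∈C (inj₂ lt) (inj₂ lt′) with v ≟ e
        ... | yes _ = refl
        ... | no v≢e = cong suc (stable m m′ (next-∈ b v∈C) (shrink lt (descent v∈C v≢e)) (shrink lt′ (descent v∈C v≢e)))
          where
          shrink : ∀ {m} → ρ v < suc m → nx v ≡ e ⊎ ρ (nx v) < ρ v → nx v ≡ e ⊎ ρ (nx v) < m
          shrink _ (inj₁ eq) = inj₁ eq
          shrink lt (inj₂ lt′) = inj₂ (<-≤-trans lt′ (≤-pred lt))
        δ : Fin n → ℕ
        δ v = count (suc (ρ v)) v
        δ-step : Distance δ
        δ-step v v∈C with v ≟ e
        ... | yes eq = inj₁ (eq , refl)
        ... | no v≢e = inj₂ (v≢e , cong suc (stable (ρ v) (suc (ρ (nx v))) (next-∈ b v∈C) (descent v∈C v≢e) (inj₂ ≤-refl)))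

    δ : Fin n → ℕ
    δ = proj₁ distance

    δ-step : Distance δ
    δ-step = proj₂ distance

    δ-injective : ∀ m {v w} → δ v ≡ m → v ∈ C b → w ∈ C b → δ v ≡ δ w → v ≡ w
    δ-injective m {v} {w} v≡m v∈C w∈C eq with δ-step v v∈C | δ-step w w∈C
    ... | inj₁ (v≡e , _) | inj₁ (w≡e , _) = trans v≡e (sym w≡e)
    ... | inj₁ (_ , v≡0) | inj₂ (_ , w≡s) = ⊥-elim (0≢1+n (trans (sym v≡0) (trans eq w≡s)))
    ... | inj₂ (_ , v≡s) | inj₁ (_ , w≡0) = ⊥-elim (0≢1+n (trans (sym w≡0) (trans (sym eq) v≡s)))
    δ-injective zero v≡m _ _ _ | inj₂ (_ , v≡s) | inj₂ _ = ⊥-elim (0≢1+n (trans (sym v≡m) v≡s))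
    δ-injective (suc m) {v} {w} v≡m v∈C w∈C eq | inj₂ (_ , v≡s) | inj₂ (_ , w≡s) =
      trans (sym (prev-next b v)) (trans (cong (prev b)
        (δ-injective m (suc-injective (trans (sym v≡s) v≡m)) (next-∈ b v∈C) (next-∈ b w∈C)
          (suc-injective (trans (sym v≡s) (trans eq w≡s))))) (prev-next b w))

    module _ {t} (t∈C : t ∈ C b) (pt : E (prev a c) t) where

      -- The stretch of the cycle from `p` to `e` returns to `c` through the arc `e → c`, so `block`
      -- places `t` on it.
      behind : ∀ {p t} → p ∈ C b → E c p → t ∈ C b → E (prev a c) t → δ t ≤ δ p
      behind {p} p∈C cp t∈C pt = proj₂ (∈⁻ (block S (proj₁ ∘ ∈⁻) closed (∈⁺ (p∈C , ≤-refl)) cp t∈C pt))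
        where
        S : Subset n
        S = ⟪ (λ v → (v ∈? C b) ×-dec (δ v ≤? δ p)) ⟫
        closed : ∀ v → v ∈ S → nx v ∈ S ⊎ E v c
        closed v v∈ with v∈C , v≤p ← ∈⁻ v∈ with δ-step v v∈C
        ... | inj₁ (refl , _) = inj₂ ec
        ... | inj₂ (_ , v≡s) = inj₁ (∈⁺ (next-∈ b v∈C , <⇒≤ (subst (_≤ δ p) v≡s v≤p)))

      -- Apply `dichotomy` to `c → p₂`. An arc from `prev a c` to `p₂` contradicts `behind` for
      -- `p₃`. Otherwise the predecessor of `p₂` has an arc to `c`, so `block` puts `t` on the
      -- stretch from `p₁` to that predecessor, whereas `behind` keeps `t` no farther from `e` than
      -- `p₃`.
      sorted : ∀ {p₁ p₂ p₃} → p₁ ∈ C b → p₂ ∈ C b → p₃ ∈ C b → E c p₁ → E c p₂ → E c p₃ →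
        δ p₃ < δ p₂ → δ p₂ < δ p₁ → ⊥
      sorted {p₁} {p₂} {p₃} p₁∈C p₂∈C p₃∈C cp₁ cp₂ cp₃ p₃<p₂ p₂<p₁
        with dichotomy c∈C (C⊆V p₂∈C) (lab-C p₂∈C) cp₂
      ... | inj₁ pp₂ = n≮n _ (<-≤-trans p₃<p₂ (behind p₃∈C cp₃ p₂∈C pp₂))
      ... | inj₂ (z , z∈C , nz≡p₂ , zc) =
        n≮n _ (<-≤-trans (proj₁ (proj₂ (∈⁻ t∈S))) (≤-trans (behind p₃∈C cp₃ t∈C pt) (<⇒≤ p₃<p₂)))
        where
        S : Subset n
        S = ⟪ (λ v → (v ∈? C b) ×-dec (δ p₂ <? δ v) ×-dec (δ v ≤? δ p₁)) ⟫
        closed : ∀ v → v ∈ S → nx v ∈ S ⊎ E v c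
        closed v v∈ with v∈C , p₂<v , v≤p₁ ← ∈⁻ v∈ with δ-step v v∈C
        ... | inj₁ (refl , _) = inj₂ ec
        ... | inj₂ (_ , v≡s) with m≤n⇒m<n∨m≡n (≤-pred (subst (δ p₂ <_) v≡s p₂<v))
        ...   | inj₁ p₂<nv = inj₁ (∈⁺ (next-∈ b v∈C , p₂<nv , <⇒≤ (subst (_≤ δ p₁) v≡s v≤p₁)))
        ...   | inj₂ p₂≡nv = inj₂ (subst (λ x → E x c) (sym v≡z) zc)
          where
          v≡z : v ≡ z
          v≡z = trans (sym (prev-next b v)) (trans (cong (prev b) (trans
            (sym (δ-injective _ refl p₂∈C (next-∈ b v∈C) p₂≡nv)) (sym nz≡p₂))) (prev-next b z))
        t∈S : t ∈ S
        t∈S = block S (proj₁ ∘ ∈⁻) closed (∈⁺ (p₁∈C , p₂<p₁ , ≤-refl)) cp₁ t∈C pt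

      no-three : ∀ {p q r} → p ∈ C b → q ∈ C b → r ∈ C b → E c p → E c q → E c r → p ≢ q → p ≢ r → q ≢ r → ⊥
      no-three {p} {q} {r} p∈C q∈C r∈C cp cq cr p≢q p≢r q≢r
        with <-cmp (δ p) (δ q) | <-cmp (δ p) (δ r) | <-cmp (δ q) (δ r)
      ... | tri≈ _ eq _ | _ | _ = p≢q (δ-injective _ refl p∈C q∈C eq)
      ... | _ | tri≈ _ eq _ | _ = p≢r (δ-injective _ refl p∈C r∈C eq)
      ... | _ | _ | tri≈ _ eq _ = q≢r (δ-injective _ refl q∈C r∈C eq)
      ... | tri< p<q _ _ | _ | tri< q<r _ _ = sorted r∈C q∈C p∈C cr cq cp p<q q<r
      ... | _ | tri< p<r _ _ | tri> _ _ r<q = sorted q∈C r∈C p∈C cq cr cp p<r r<q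
      ... | tri> _ _ q<p | tri< p<r _ _ | _ = sorted r∈C p∈C q∈C cr cp cq q<p p<r
      ... | tri< p<q _ _ | tri> _ _ r<p | _ = sorted q∈C p∈C r∈C cq cp cr r<p p<q
      ... | _ | tri> _ _ r<p | tri< q<r _ _ = sorted p∈C r∈C q∈C cp cr cq q<r r<p
      ... | tri> _ _ q<p | _ | tri> _ _ r<q = sorted p∈C q∈C r∈C cp cq cr r<q q<p

      off-core : ∀ x → ∃ λ y → Common a y × y ≢ x
      off-core x
        with p , p∈V , p≡J , cp , p≢x ∷ [] ← J-neighbour c∈C (x ∷ []) (s≤s z≤n)
        with q , q∈V , q≡J , cq , q≢x ∷ q≢p ∷ [] ← J-neighbour c∈C (x ∷ p ∷ []) (s≤s (s≤s z≤n))
        with r , r∈V , r≡J , cr , r≢x ∷ r≢p ∷ r≢q ∷ [] ← J-neighbour c∈C (x ∷ p ∷ q ∷ []) (s≤s (s≤s (s≤s z≤n)))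
        with p ∈? C b | q ∈? C b | r ∈? C b
      ... | no p∉C | _ | _ = p , common-off-core c∈C p∈V p≡J cp p∉C , p≢x
      ... | _ | no q∉C | _ = q , common-off-core c∈C q∈V q≡J cq q∉C , q≢x
      ... | _ | _ | no r∉C = r , common-off-core c∈C r∈V r≡J cr r∉C , r≢x
      ... | yes p∈C | yes q∈C | yes r∈C =
        ⊥-elim (no-three p∈C q∈C r∈C cp cq cr (q≢p ∘ sym) (r≢p ∘ sym) (r≢q ∘ sym))

  -- Without arcs from the next core back to `C a`, `dichotomy` passes every target on to the
  -- predecessor. Given such an arc `e → c`, either `prev a c` has no out-neighbour on the next
  -- core, or `no-three` leaves `c` a target off it; targets off the core are common.
  another-common : ∀ a x → ∃ λ y → Common a y × y ≢ x
  another-common a x with any? (λ c → any? λ e → (c ∈? C a) ×-dec (e ∈? C (J a)) ×-dec E? e c)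
  ... | no none with c , c∈C ← inhab a with y , y∈V , y≡J , cy , y≢x ∷ [] ← J-neighbour c∈C (x ∷ []) (s≤s z≤n) =
    y , common c∈C y∈V y≡J cy (λ {c′} {z} c′∈C z∈C _ zc → none (c′ , z , c′∈C , z∈C , zc)) , y≢x
  ... | yes (c , e , c∈C , e∈C , ec) with any? (λ t → (t ∈? C (J a)) ×-dec E? (prev a c) t)
  ...   | yes (t , t∈C , pt) = Returning.off-core c∈C e∈C ec t∈C pt x
  ...   | no none with y , y∈V , y≡J , py , y≢x ∷ [] ← J-neighbour (prev-∈ a c∈C) (x ∷ []) (s≤s z≤n) =
    y , common-off-core (prev-∈ a c∈C) y∈V y≡J py (λ y∈C → none (y , y∈C , py)) , y≢x

  -- Two entries for every part, and the final splitting.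

  Entry : I → Set
  Entry b = ∃ λ p → ∃ λ p′ → p ∈ Part b × p′ ∈ Part b × p ≢ p′ × (∀ {a c} → J a ≡ b → c ∈ C a → E c p × E c p′)

  opaque
    entry : ∀ b → Entry b
    -- The vertex avoided here is arbitrary; the second call avoids `p`.
    entry b with p , (p∈V , p≡J , all) , _ ← another-common (J⁻¹ b) (proj₁ (inhab b))
            with p′ , (p′∈V , p′≡J , all′) , p′≢p ← another-common (J⁻¹ b) p =
      p , p′ , ∈⁺ (p∈V , trans p≡J (J-J⁻¹ b)) , ∈⁺ (p′∈V , trans p′≡J (J-J⁻¹ b)) , p′≢p ∘ sym ,
      λ {a} {c} Ja≡b c∈C → let c∈C′ = subst (λ j → c ∈ C j) (trans (sym (J⁻¹-J a)) (cong J⁻¹ Ja≡b)) c∈C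
                           in all c∈C′ , all′ c∈C′

  -- By `exit-in`, a nonempty self-sustaining subset of a part contains all its exits, and every
  -- core vertex is one.
  off-core-acyclic : ∀ b → Acyclic E V ⟪ (λ v → (v ∈? Part b) ×-dec ¬? (v ∈? C b)) ⟫
  off-core-acyclic b X X⊆ X-self v v∈X with l , l∈C ← inhab b =
    proj₂ (∈⁻ (X⊆ (exit-in X-self
      (λ x∈ → let x∈V , x≡b = ∈⁻ (proj₁ (∈⁻ (X⊆ x∈))) in ∈⁺ (x∈V , trans x≡b (sym (lab-C l∈C))))
      (v , v∈X) (C⊆V l∈C) (core⇒exit l∈C)))) l∈C

  part-stays : ∀ b {v w} → v ∈ Part b → v ∉ C b → w ∈ V → E v w → w ∈ Part b
  part-stays b {v} v∈ v∉C w∈V vw with v∈V , refl ← ∈⁻ v∈ = ∈⁺ (w∈V , lab-stays v∈V v∉C w∈V vw)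

  module T b = Tokens (Part b) (C b) (proj₁ ∘ ∈⁻) (part-stays b) (off-core-acyclic b)

  -- Flows may stop on the cores, but a core vertex of part `b` continues at the entry chosen in
  -- part `J b`.
  assemble : (S : I → Subset n) (q : I → Fin n) → (∀ b → T.Flow b (S b)) → (∀ b → q b ∈ S b) →
    (∀ {a c} → c ∈ C a → E c (q (J a))) → Self E V ⟪ (λ v → any? λ b → v ∈? S b) ⟫
  assemble S q flow q∈S arcs = (λ v∈ → let b , v∈S = ∈⁻ v∈ in proj₁ (∈⁻ (proj₁ (flow b) v∈S))) , next′
    where
    next′ : ∀ v → v ∈ ⟪ (λ v → any? λ b → v ∈? S b) ⟫ → ∃ λ w → w ∈ ⟪ (λ v → any? λ b → v ∈? S b) ⟫ × E v w
    next′ v v∈ with b , v∈S ← ∈⁻ v∈ with v ∈? C b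
    ... | yes v∈C = q (J b) , ∈⁺ (J b , q∈S (J b)) , arcs v∈C
    ... | no v∉C = let w , w∈S , vw = proj₂ (flow b) v v∈S v∉C in w , ∈⁺ (b , w∈S) , vw

  absurd : ⊥
  absurd = no-single u (proj₁ (∈⁻ u∈) , λ w w∈V w≢u → case lab w ≟ zero of λ where
      (yes w≡0) → sep w (∈⁺ (w∈V , w≡0)) w≢u
      (no w≢0) → sep-parts (proj₁ (∈⁻ u∈)) w∈V λ eq → w≢0 (trans (sym eq) (proj₂ (∈⁻ u∈))))
    where
    p p′ : I → Fin n
    p b = proj₁ (entry b)
    p′ b = proj₁ (proj₂ (entry b))
    p∈ : ∀ b → p b ∈ Part b
    p∈ b = proj₁ (proj₂ (proj₂ (entry b)))
    p′∈ : ∀ b → p′ b ∈ Part b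
    p′∈ b = proj₁ (proj₂ (proj₂ (proj₂ (entry b))))
    p≢p′ : ∀ b → p b ≢ p′ b
    p≢p′ b = proj₁ (proj₂ (proj₂ (proj₂ (proj₂ (entry b)))))
    arcs : ∀ b {a c} → J a ≡ b → c ∈ C a → E c (p b) × E c (p′ b)
    arcs b = proj₂ (proj₂ (proj₂ (proj₂ (proj₂ (entry b)))))
    u : Fin n
    u = p zero
    u∈ : u ∈ Part zero
    u∈ = p∈ zero
    sep : ∀ w → w ∈ Part zero → w ≢ u → Sep E V u w
    sep w w∈ w≢u = ⟪ (λ v → any? λ b → v ∈? S b) ⟫ , ⟪ (λ v → any? λ b → v ∈? S′ b) ⟫ ,
      assemble S p flow p∈S (λ c∈C → proj₁ (arcs _ refl c∈C)) ,
      assemble S′ p′ flow′ p′∈S′ (λ c∈C → proj₂ (arcs _ refl c∈C)) ,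
      (λ v v∈ v∈′ → apart (∈⁻ v∈) (∈⁻ v∈′)) , ∈⁺ (zero , p∈S zero) , ∈⁺ (zero , w∈S′)
      where
      -- In the part of `u`, the set opposite `u` must hold `w` as well as the entry `p′`; in all
      -- other parts its two tokens coincide.
      opponent : I → Fin n
      opponent zero = w
      opponent (suc b) = p′ (suc b)
      opponent∈ : ∀ b → opponent b ∈ Part b
      opponent∈ zero = w∈
      opponent∈ (suc b) = p′∈ (suc b)
      opponent≢ : ∀ b → p b ≢ opponent b
      opponent≢ zero = w≢u ∘ sym
      opponent≢ (suc b) = p≢p′ (suc b)
      splits : ∀ b → T.Split b (p b) (opponent b) (p′ b)
      splits b = T.split b (p∈ b) (opponent∈ b) (p′∈ b) (opponent≢ b) (p≢p′ b)
      S S′ : I → Subset n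
      S b = proj₁ (splits b)
      S′ b = proj₁ (proj₂ (splits b))
      flow : ∀ b → T.Flow b (S b)
      flow b = proj₁ (proj₂ (proj₂ (splits b)))
      flow′ : ∀ b → T.Flow b (S′ b)
      flow′ b = proj₁ (proj₂ (proj₂ (proj₂ (splits b))))
      disj : ∀ b → Disjoint (S b) (S′ b)
      disj b = proj₁ (proj₂ (proj₂ (proj₂ (proj₂ (splits b)))))
      p∈S : ∀ b → p b ∈ S b
      p∈S b = proj₁ (proj₂ (proj₂ (proj₂ (proj₂ (proj₂ (splits b))))))
      w∈S′ : w ∈ S′ zero
      w∈S′ = proj₁ (proj₂ (proj₂ (proj₂ (proj₂ (proj₂ (proj₂ (splits zero)))))))
      p′∈S′ : ∀ b → p′ b ∈ S′ b
      p′∈S′ b = proj₁ (proj₂ (proj₂ (proj₂ (proj₂ (proj₂ (proj₂ (proj₂ (splits b))))))))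
      apart : ∀ {v} → (∃ λ b → v ∈ S b) → ¬ (∃ λ b → v ∈ S′ b)
      apart {v} (b , v∈S) (b′ , v∈S′) = disj b v v∈S (subst (λ j → v ∈ S′ j)
        (trans (sym (proj₂ (∈⁻ (proj₁ (flow′ b′) v∈S′)))) (proj₂ (∈⁻ (proj₁ (flow b) v∈S)))) v∈S′)

-- Choosing a maximum packing, and the induction on the vertex set.

module Contradiction {n : ℕ} {E : Fin n → Fin n → Set} (E? : ∀ v w → Dec (E v w)) {V : Subset n}
  (smaller : Smaller V) (big : Big E V) (no-single : ∀ u → ¬ Single E V u) where

  opaque
    -- Downward induction on the size of the packing: more than `n` disjoint nonempty sets cannot
    -- exist, and the case of the next larger size supplies the maximality that `Colouring` asks
    -- for.
    no-packing : ∀ d k → n < d + suc (suc k) → ¬ Packing E V (suc (suc k))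
    no-packing zero k n<k P = n≮n _ (<-≤-trans n<k (injective⇒≤ {f = proj₁ ∘ inhab}
        λ {i} {j} eq → disjoint (proj₂ (inhab i)) (subst (_∈ C j) (sym eq) (proj₂ (inhab j)))))
      where open Packing P
    no-packing (suc d) k n<d P = Colouring.absurd E? smaller big no-single
        (record { C = proj₁ ∘ refined ; self = proj₁ ∘ min ; inhab = proj₁ ∘ proj₂ ∘ min
                ; disjoint = λ {i} {j} p q → disjoint (proj₁ (proj₂ (refined i)) p) (proj₁ (proj₂ (refined j)) q) })
        min (no-packing d (suc k) (subst (n <_) (sym (+-suc d (suc (suc k)))) n<d))
      where
      open Packing P
      refined : ∀ i → ∃ λ S → S ⊆ C i × Minimal E V S
      refined i = minimal E? (C i) (self i) (inhab i)
      min : ∀ i → Minimal E V (proj₁ (refined i))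
      min i = proj₂ (proj₂ (refined i))

  absurd : ¬ Nonempty V
  absurd V≠∅ with any? (λ u → any? λ w → sep? E? {V} u w)
  ... | no ¬sep = Existence.absurd E? smaller big no-single V≠∅ (λ u w s → ¬sep (u , w , s))
  ... | yes (u , w , S , S′ , S-self , S′-self , d , u∈S , w∈S′) =
    no-packing n 0 (m<m+n n (s≤s z≤n)) record
      { C = C ; self = λ { zero → S-self ; (suc zero) → S′-self }
      ; inhab = λ { zero → u , u∈S ; (suc zero) → w , w∈S′ } ; disjoint = λ {i} {j} → disjoint i j }
    where
    C : Fin 2 → Subset n
    C zero = S
    C (suc zero) = S′
    disjoint : ∀ i j {v} → v ∈ C i → v ∈ C j → i ≡ j
    disjoint zero zero _ _ = refl
    disjoint zero (suc zero) p q = ⊥-elim (d _ p q)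
    disjoint (suc zero) zero p q = ⊥-elim (d _ q p)
    disjoint (suc zero) (suc zero) _ _ = refl

single-exists : ∀ {n} {E : Fin n → Fin n → Set} (V : Subset n) → Acc _⊂_ V → (∀ v w → Dec (E v w)) →
  Nonempty V → Big E V → ∃ (Single E V)
single-exists V (acc rs) E? V≠∅ big with any? (single? E? {V})
... | yes s = s
... | no ¬s = ⊥-elim (Contradiction.absurd E?
  (λ E′? {V′} V′⊂V → single-exists V′ (rs V′⊂V) E′?) big (λ u s → ¬s (u , s)) V≠∅)

-- From self-sustaining sets back to digraphs and friendly partitions.

fresh : ∀ {n} (ys xs : List (Fin n)) → Unique ys → length xs < length ys → ∃ λ y → y ∈ₗ ys × All (y ≢_) xs
fresh (y ∷ ys) xs (y∉ys ∷ u) lt with Any.any? (y ≟_) xs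
... | no y∉xs = y , here refl , All.¬Any⇒All¬ xs y∉xs
-- Striking the head from `xs` shortens it enough for the induction, and uniqueness keeps the tail
-- clear of the head.
... | yes y∈xs with z , z∈ys , new ← fresh ys (filter (λ x → ¬? (y ≟ x)) xs) u
                (<-≤-trans (filter-notAll _ xs (Any.map (λ y≡x y≢x → y≢x y≡x) y∈xs)) (≤-pred lt))
  = z , there z∈ys , All.tabulate λ x∈xs z≡x →
      All.lookup new (∈-filter⁺ _ x∈xs λ y≡x → All.lookup y∉ys z∈ys (trans y≡x (sym z≡x))) z≡x

-- The `true` side is the union of all self-sustaining sets disjoint from `S′`. A vertex outside
-- this union and outside `S′` has no out-neighbour in the union, or it could be added; so all its
-- out-neighbours share its side.
sep⇒friendly : ∀ {n} (G : Digraph n) → (∀ v → ∃ λ w → arc G v w ≡ true) → ∀ {u w} →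
  Sep (λ v w → arc G v w ≡ true) ⊤ u w → ∃ λ side → Friendly G side × Separates side u w
sep⇒friendly {n} G out {u} {w} (S , S′ , S-self , S′-self , d , u∈S , w∈S′) =
  side , ((u , side-u) , (w , side-w) , friend) , λ eq → case trans (sym side-u) (trans eq side-w) of λ ()
  where
  E? : ∀ v w → Dec (arc G v w ≡ true)
  E? v w = arc G v w Bool.≟ true
  Red : Fin n → Set
  Red v = ∃ λ X → Self (λ v w → arc G v w ≡ true) ⊤ X × Disjoint X S′ × v ∈ X
  red? : ∀ v → Dec (Red v)
  red? v = anySubset? λ X → self? E? X ×-dec disjoint? X S′ ×-dec (v ∈? X)
  side : Fin n → Bool
  side v = does (red? v)
  side-u : side u ≡ true
  side-u = dec-true (red? u) (S , S-self , d , u∈S)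
  blue : ∀ {v} → v ∈ S′ → ¬ Red v
  blue v∈S′ (_ , _ , d′ , v∈X) = d′ _ v∈X v∈S′
  side-w : side w ≡ false
  side-w = dec-false (red? w) (blue w∈S′)
  friend : ∀ v → ∃ λ w → arc G v w ≡ true × side w ≡ side v
  friend v with red? v
  ... | yes (X , X-self , d′ , v∈X) = let x , x∈X , vx = proj₂ X-self v v∈X in
    x , vx , dec-true (red? x) (X , X-self , d′ , x∈X)
  ... | no ¬red with v ∈? S′
  ...   | yes v∈S′ = let x , x∈S′ , vx = proj₂ S′-self v v∈S′ in x , vx , dec-false (red? x) (blue x∈S′)
  ...   | no v∉S′ = let x , vx = out v in x , vx , dec-false (red? x) (λ r → ¬red (extend vx r))
    where
    extend : ∀ {x} → arc G v x ≡ true → Red x → Red v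
    extend vx (X , X-self , d′ , x∈X) = add v X , self-add E? X-self ∈⊤ x∈X vx , d″ , ∈⁺ (inj₂ refl)
      where
      d″ : Disjoint (add v X) S′
      d″ z z∈ with ∈⁻ z∈
      ... | inj₁ z∈X = d′ z z∈X
      ... | inj₂ refl = v∉S′

min-degree⇒big : ∀ {n} (G : Digraph n) → MinOutDegAtLeast G 15 → Big (λ v w → arc G v w ≡ true) ⊤
min-degree⇒big G deg v _ xs len
  with w , w∈ , new ← fresh (outNbrs G v) xs (filter⁺ _ (allFin⁺ _)) (≤-trans (s≤s len) (deg v))
  = w , ∈⊤ , proj₂ (∈-filter⁻ (λ w → arc G v w Bool.≟ true) {xs = allFin _} w∈) , new

theorem1p6 : (n : ℕ) → .{{NonZero n}} → (G : Digraph n) → MinOutDegAtLeast G 15 →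
    ∃ λ (u : Fin n) → (w : Fin n) → w ≢ u →
    ∃ λ (side : Fin n → Bool) → Friendly G side × Separates side u w
theorem1p6 zero {{n≢0}} G deg = ⊥-elim (≢-nonZero⁻¹ 0 {{n≢0}} refl)
theorem1p6 (suc n) G deg =
  let big = min-degree⇒big G deg
      u , _ , sep = single-exists ⊤ (⊂-wellFounded ⊤) (λ v w → arc G v w Bool.≟ true) (zero , ∈⊤) big
  in u , λ w w≢u → sep⇒friendly G (λ v → let x , _ , vx , _ = big v ∈⊤ [] z≤n in x , vx) (sep w ∈⊤ w≢u)
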